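{- In the abelian case, the map $w\mapsto\Gamma_w:=\min(\Delta(1)\setminus N(w))$ is a bijection from $W^0$ onto the set $\mathrm{AN}(\Delta(1))$ of antichains of $\Delta(1)$. Furthermore, for $w\in W^0$: (i) $I_w:=\Delta(1)\setminus N(w)$ is an upper ideal of $\Delta(1)$; (ii) for $\gamma\in I_w$, $\gamma\in\min(I_w)$ if and only if $w(\gamma)\in\Pi$; i.e. $\Gamma_w=\min(I_w)=w^{ -1}(\Pi)\cap\Delta(1)$; (iii) for $\gamma\in N(w)$, $\gamma\in\max(N(w))$ if and only if $w(\gamma)\in-\Pi$; i.e. $\max(N(w))=\max(\Delta(1)\setminus I_w)=-w^{ -1}(\Pi)\cap\Delta(1)$. In particular, $\#\mathrm{AN}(\Delta(1))=\#(W/W(0))$ and $\#I_w=\dim\mathfrak g(1)-\ell(w)$.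
   Context: Let $\mathfrak g$ be a complex simple Lie algebra with Cartan subalgebra $\mathfrak t$, root system $\Delta$, positive roots $\Delta^+$, simple roots $\Pi$, Weyl group $W$ with length function $\ell$, and highest root $\theta$. For $\gamma\in\Delta$ and $\alpha\in\Pi$, $[\gamma:\alpha]$ is the coefficient of $\alpha$ in $\gamma$. Abelian case: fix $\alpha_i\in\Pi$ with $[\theta:\alpha_i]=1$, and put $\Delta(j)=\{\gamma\in\Delta:[\gamma:\alpha_i]=j\}$, so $\Delta=\Delta(-1)\sqcup\Delta(0)\sqcup\Delta(1)$ and $\Delta^+=\Delta(0)^+\sqcup\Delta(1)$ with $\Delta(0)^+=\Delta(0)\cap\Delta^+$. Let $\mathfrak g(1)$ be the sum of the root spaces for $\Delta(1)$ (so $\dim\mathfrak g(1)=\#\Delta(1)$). Let $\Pi(0)=\Pi\setminus\{\alpha_i\}$ and $W(0)$ the subgroup of $W$ generated by the reflections $s_\alpha$, $\alpha\in\Pi(0)$. $W^0=\{w\in W: w(\alpha)\in\Delta^+\ \forall\alpha\in\Delta(0)^+\}$ (minimal length coset representatives of $W/W(0)$). $N(w)=\{\gamma\in\Delta^+: w(\gamma)\in-\Delta^+\}$ is the inversion set. $\Delta(1)$ is partially ordered by $\mu\preccurlyeq\gamma$ iff $\gamma-\mu$ is a nonnegative integer combination of $\Pi(0)$. An upper ideal $I$ of a poset satisfies $x\in I,\ x\preccurlyeq y\Rightarrow y\in I$; $\min(M)$, $\max(M)$ denote the sets of minimal/maximal elements of $M$. -}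

module Defs where

open import Data.Nat as ℕ using (ℕ)
open import Data.Integer as ℤ using (ℤ; +_; _+_; _*_; _-_; -_)
open import Data.Fin as Fin using (Fin)
open import Data.Vec as Vec using (Vec; lookup; tabulate; zipWith; map)
open import Data.List as List using (List; []; _∷_; length; _++_)
open import Data.List.Membership.Propositional using (_∈_)
open import Data.List.Relation.Unary.All using (All)
open import Data.List.Relation.Unary.Unique.Propositional using (Unique)
open import Data.Product using (Σ; ∃; ∃₂; _×_; proj₁)
open import Data.Bool using (Bool; true; false; if_then_else_)
open import Relation.Nullary using (¬_)
open import Relation.Nullary.Decidable using (⌊_⌋)
open import Relation.Binary.PropositionalEquality using (_≡_; _≢_)
open import Function.Bundles using (_⇔_)

-- A square integer matrix of size n (Cartan matrix, Kac convention:
-- A j k = ⟨α_k , α_j^∨⟩).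
Matrix : ℕ → Set
Matrix n = Fin n → Fin n → ℤ

∑ : ∀ {n} → (Fin n → ℤ) → ℤ
∑ {ℕ.zero} f = + 0
∑ {ℕ.suc n} f = f Fin.zero + ∑ (λ k → f (Fin.suc k))

-- Indecomposable Cartan matrix of finite type, i.e. the Cartan matrix of a
-- complex simple Lie algebra: generalized Cartan matrix, symmetrizable with
-- positive-definite symmetrization, and connected Dynkin diagram.
record IsSimpleCartan {n : ℕ} (A : Matrix n) : Set where
  field
    diag           : ∀ j → A j j ≡ + 2
    offdiag        : ∀ j k → j ≢ k → A j k ℤ.≤ + 0
    zero-sym       : ∀ j k → A j k ≡ + 0 → A k j ≡ + 0
    d              : Fin n → ℕ
    d-pos          : ∀ j → 0 ℕ.< d j
    symm           : ∀ j k → + d j * A j k ≡ + d k * A k j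
    posdef         : ∀ (v : Fin n → ℤ) → (∃ λ j → v j ≢ + 0) →
                     + 0 ℤ.< ∑ (λ j → ∑ (λ k → v j * (+ d j * A j k) * v k))
    indecomposable : ∀ (S : Fin n → Bool) → (∃ λ j → S j ≡ true) → (∃ λ k → S k ≡ false) →
                     ∃₂ λ j k → S j ≡ true × S k ≡ false × A j k ≢ + 0

-- Root-system notions; vectors are coordinates w.r.t. the simple roots Π.
-- i is the fixed simple root α_i.
module RS {n : ℕ} (A : Matrix n) (i : Fin n) where

  V : Set
  V = Vec ℤ n

  e : Fin n → V
  e k = tabulate (λ l → if ⌊ k Fin.≟ l ⌋ then + 1 else + 0)

  pair : V → Fin n → ℤ
  pair v j = ∑ (λ k → lookup v k * A j k)

  s : Fin n → V → V
  s j v = zipWith _-_ v (map (pair v j *_) (e j))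

  -- elements of W as words in simple reflections, s_{j1} ... s_{jk}
  Word : Set
  Word = List (Fin n)

  act : Word → V → V
  act [] v = v
  act (j ∷ w) v = s j (act w v)

  -- equality in W (W acts faithfully on the root lattice)
  _≈W_ : Word → Word → Set
  w ≈W v = ∀ x → act w x ≡ act v x

  IsRoot : V → Set
  IsRoot γ = ∃₂ λ (w : Word) (k : Fin n) → γ ≡ act w (e k)

  Simple : V → Set
  Simple γ = ∃ λ k → γ ≡ e k

  PosRoot : V → Set
  PosRoot γ = IsRoot γ × (∀ k → + 0 ℤ.≤ lookup γ k)

  NegRoot : V → Set
  NegRoot γ = PosRoot (map -_ γ)

  IsHighestRoot : V → Set
  IsHighestRoot θ = IsRoot θ × (∀ γ → IsRoot γ → ∀ k → lookup γ k ℤ.≤ lookup θ k)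

  Δ1 : V → Set
  Δ1 γ = IsRoot γ × lookup γ i ≡ + 1

  Δ0⁺ : V → Set
  Δ0⁺ γ = PosRoot γ × lookup γ i ≡ + 0

  InW0 : Word → Set
  InW0 w = ∀ α → Δ0⁺ α → PosRoot (act w α)

  N : Word → V → Set
  N w γ = PosRoot γ × NegRoot (act w γ)

  -- μ ≼ γ : γ - μ is a nonnegative integer combination of Π(0)
  _≼_ : V → V → Set
  μ ≼ γ = (∀ k → lookup μ k ℤ.≤ lookup γ k) × (lookup γ i - lookup μ i ≡ + 0)

  Min : (V → Set) → V → Set
  Min M γ = M γ × (∀ μ → M μ → μ ≼ γ → μ ≡ γ)

  Max : (V → Set) → V → Set
  Max M γ = M γ × (∀ μ → M μ → γ ≼ μ → μ ≡ γ)

  I : Word → V → Set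
  I w γ = Δ1 γ × ¬ N w γ

  Γ : Word → V → Set
  Γ w = Min (I w)

  UpperIdeal : (V → Set) → Set
  UpperIdeal M = (∀ γ → M γ → Δ1 γ) × (∀ γ μ → M γ → Δ1 μ → γ ≼ μ → M μ)

  -- antichains of Δ(1), as finite subsets (lists, compared up to membership)
  IsAntichain : List V → Set
  IsAntichain L = All Δ1 L × (∀ x y → x ∈ L → y ∈ L → x ≼ y → x ≡ y)

  Antichain : Set
  Antichain = Σ (List V) IsAntichain

  SameSet : List V → List V → Set
  SameSet L M = ∀ γ → (γ ∈ L) ⇔ (γ ∈ M)

  W0word : Word → Set
  W0word u = All (λ j → j ≢ i) u

  CosetEq : Word → Word → Set
  CosetEq w v = ∃ λ u → W0word u × (v ≈W (w ++ u))

  IsLength : Word → ℕ → Set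
  IsLength w k = (∃ λ u → length u ≡ k × (u ≈W w)) × (∀ u → u ≈W w → k ℕ.≤ length u)

  Enumerates : List V → (V → Set) → Set
  Enumerates L P = Unique L × (∀ γ → (γ ∈ L) ⇔ P γ)

  -- #(W/W(0)) = #AN(Δ(1)): a bijection between W/W(0) and the antichains
  CosetAntichainBij : Set
  CosetAntichainBij =
    ∃ λ (f : Word → Antichain) →
        (∀ w v → CosetEq w v → SameSet (proj₁ (f w)) (proj₁ (f v)))
      × (∀ w v → SameSet (proj₁ (f w)) (proj₁ (f v)) → CosetEq w v)
      × (∀ (a : Antichain) → ∃ λ w → SameSet (proj₁ (f w)) (proj₁ a))

{-# OPTIONS --safe #-}

-- Let ( , ) be the invariant form with (α_j , α_j) = 2 d_j. The roots are exactly the vectors v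
-- such that, for some j, (v , v) = 2 d_j and d_j divides every v_k d_k. The simple reflections
-- preserve this condition, it excludes vectors with coefficients of both signs, and a nonnegative
-- vector satisfying it descends to a simple root. Hence being a root is decidable, roots have a
-- sign, and a nonsimple positive root minus a suitable simple root is again a positive root.
--
-- For w ∈ W⁰, w is monotone from ≼ to the coordinatewise order, so I_w is an upper ideal, and
-- γ ∈ I_w with w(γ) simple is minimal. If w(γ) is not simple, write it as a sum of two positive
-- roots; in the abelian case one of their preimages lies in Δ(0)⁺ and the other in I_w below γ.
-- The same argument applied to -w(γ) describes max (N(w)). So Γ_w determines N(w), hence w, and
-- every lower ideal is an N(w), obtained by adding elements of increasing height, each of which
-- extends w by a simple reflection on the left.
module Submission where

open import Defs
open import Data.Nat as ℕ using (ℕ; zero; suc)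
import Data.Nat.Properties as ℕₚ
open import Data.Integer as ℤ using (ℤ; +_; -_; _-_; _*_; _≤_; _<_; -[1+_]; +≤+; +<+; -≤-)
import Data.Integer.Properties as ℤₚ
open import Data.Integer.Divisibility.Signed
open import Data.Integer.Tactic.RingSolver using (solve-∀)
open import Data.Bool using (if_then_else_)
open import Data.Empty using (⊥; ⊥-elim)
open import Data.Fin as Fin using (Fin; zero; suc)
import Data.Fin.Properties as Finₚ
open import Data.Vec as Vec using (Vec; lookup; map)
import Data.Vec.Properties as Vecₚ
open import Data.List as List using (List; []; _∷_; _++_; _∷ʳ_; _∷ʳ′_; initLast; reverse; length)
import Data.List.Properties as Listₚ
open import Data.List.Extrema ℤₚ.≤-totalOrder using (argmax; argmax-sel; f[xs]≤f[argmax]; f[⊥]≤f[argmax])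
open import Data.List.Membership.Propositional using (_∈_; lose; find)
open import Data.List.Membership.Propositional.Properties
open import Data.List.Membership.Propositional.Properties.WithK using (unique∧set⇒bag)
open import Data.List.Relation.Binary.BagAndSetEquality using (∼bag⇒↭)
open import Data.List.Relation.Binary.Permutation.Propositional using (↭-sym)
open import Data.List.Relation.Binary.Permutation.Propositional.Properties
  using (↭-length; ↭-reverse; All-resp-↭)
open import Data.List.Relation.Unary.All as All using (All; []; _∷_)
import Data.List.Relation.Unary.All.Properties as Allₚ
open import Data.List.Relation.Unary.AllPairs using ([]; _∷_)
open import Data.List.Relation.Unary.Any as Any using (Any; here; there)
open import Data.List.Relation.Unary.Unique.Propositional using (Unique)
import Data.List.Relation.Unary.Unique.Propositional.Properties as Uniqueₚ
open import Data.Product as Product using (∃; ∃₂; _×_; _,_; proj₁; proj₂)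
open import Data.Sum as Sum using (_⊎_; inj₁; inj₂; [_,_]′)
open import Function using (_∘_; id; case_of_)
open import Function.Bundles using (_⇔_; mk⇔; Equivalence)
open import Function.Properties.Equivalence using () renaming (sym to ⇔-sym; trans to ⇔-trans)
open import Relation.Nullary using (¬_; yes; no; Dec)
open import Relation.Nullary.Decidable using (⌊_⌋; map′; _×-dec_; ¬?; decidable-stable)
open import Relation.Binary.PropositionalEquality

-- Integer inequalities, divisibility and finite sums.

module IntegerLemmas where
  open import Data.Integer using (_+_)

  private variable
    n m : ℕ

  0≤-+ : ∀ {a b} → + 0 ≤ a → + 0 ≤ b → + 0 ≤ a + b
  0≤-+ = ℤₚ.+-mono-≤

  0≤-* : ∀ {a b} → + 0 ≤ a → + 0 ≤ b → + 0 ≤ a * b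
  0≤-* {a} {b} (+≤+ {n = m} _) 0≤b =
    subst (_≤ + m * b) (ℤₚ.*-zeroʳ (+ m)) (ℤₚ.*-monoˡ-≤-nonNeg (+ m) 0≤b)

  0<-* : ∀ {a b} → + 0 < a → + 0 < b → + 0 < a * b
  0<-* {a} {b} (+<+ {n = suc m} _) 0<b =
    subst (_< + suc m * b) (ℤₚ.*-zeroʳ (+ suc m)) (ℤₚ.*-monoˡ-<-pos (+ suc m) 0<b)

  0<⇒1≤ : ∀ {a} → + 0 < a → + 1 ≤ a
  0<⇒1≤ = ℤₚ.i<j⇒suc[i]≤j

  0<-*⁻¹ : ∀ {a b} → + 0 ≤ a → + 0 < a * b → + 0 < b
  0<-*⁻¹ {a} {b} (+≤+ {n = m} _) 0<ab =
    ℤₚ.*-cancelˡ-<-nonNeg (+ m) (subst (_< + m * b) (sym (ℤₚ.*-zeroʳ (+ m))) 0<ab)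

  ∑-cong : {f g : Fin n → ℤ} → (∀ k → f k ≡ g k) → ∑ f ≡ ∑ g
  ∑-cong {zero}  h = refl
  ∑-cong {suc n} h = cong₂ _+_ (h zero) (∑-cong (h ∘ suc))

  ∑-zero : {f : Fin n → ℤ} → (∀ k → f k ≡ + 0) → ∑ f ≡ + 0
  ∑-zero {zero}  h = refl
  ∑-zero {suc n} h = cong₂ _+_ (h zero) (∑-zero (h ∘ suc))

  ∑-+ : (f g : Fin n → ℤ) → ∑ (λ k → f k + g k) ≡ ∑ f + ∑ g
  ∑-+ {zero}  f g = refl
  ∑-+ {suc n} f g = trans (cong (λ t → f zero + g zero + t) (∑-+ (f ∘ suc) (g ∘ suc)))
                          (interchange (f zero) (g zero) _ _)
    where
    interchange : ∀ a b c d → a + b + (c + d) ≡ a + c + (b + d)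
    interchange = solve-∀

  ∑-*ˡ : ∀ c (f : Fin n → ℤ) → ∑ (λ k → c * f k) ≡ c * ∑ f
  ∑-*ˡ {zero}  c f = sym (ℤₚ.*-zeroʳ c)
  ∑-*ˡ {suc n} c f = trans (cong (λ t → c * f zero + t) (∑-*ˡ c (f ∘ suc)))
                           (sym (ℤₚ.*-distribˡ-+ c (f zero) _))

  ∑-*ʳ : ∀ c (f : Fin n → ℤ) → ∑ (λ k → f k * c) ≡ ∑ f * c
  ∑-*ʳ c f = trans (∑-cong (λ k → ℤₚ.*-comm (f k) c)) (trans (∑-*ˡ c f) (ℤₚ.*-comm c _))

  ∑-lin : ∀ a (f : Fin n → ℤ) b (g : Fin n → ℤ) →
          ∑ (λ k → a * f k + b * g k) ≡ a * ∑ f + b * ∑ g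
  ∑-lin a f b g = trans (∑-+ (λ k → a * f k) (λ k → b * g k)) (cong₂ _+_ (∑-*ˡ a f) (∑-*ˡ b g))

  ∑-swap : (f : Fin n → Fin m → ℤ) → ∑ (λ j → ∑ (f j)) ≡ ∑ (λ k → ∑ (λ j → f j k))
  ∑-swap {zero}  f = sym (∑-zero {f = λ k → ∑ (λ j → f j k)} (λ _ → refl))
  ∑-swap {suc n} f = trans (cong (λ t → ∑ (f zero) + t) (∑-swap (f ∘ suc)))
                           (sym (∑-+ (f zero) (λ k → ∑ (λ j → f (suc j) k))))

  ∑-single : ∀ j {f : Fin n → ℤ} → (∀ k → j ≢ k → f k ≡ + 0) → ∑ f ≡ f j
  ∑-single zero {f} h = trans (cong (λ t → f zero + t) (∑-zero (λ k → h (suc k) λ ()))) (ℤₚ.+-identityʳ _)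
  ∑-single (suc j) h = trans (cong₂ _+_ (h zero λ ())
                                   (∑-single j (λ k j≢k → h (suc k) (j≢k ∘ Finₚ.suc-injective))))
                             (ℤₚ.+-identityˡ _)

  ∑-nonNeg : {f : Fin n → ℤ} → (∀ k → + 0 ≤ f k) → + 0 ≤ ∑ f
  ∑-nonNeg {zero}  h = ℤₚ.≤-refl
  ∑-nonNeg {suc n} h = 0≤-+ (h zero) (∑-nonNeg (h ∘ suc))

  ∑-positive-term : {f : Fin n → ℤ} → + 0 < ∑ f → ∃ λ k → + 0 < f k
  ∑-positive-term {zero}  (+<+ ())
  ∑-positive-term {suc n} {f} 0<∑ with + 0 ℤₚ.<? f zero
  ... | yes 0<f₀ = zero , 0<f₀
  ... | no  0≮f₀ with ∑-positive-term {n} {f ∘ suc}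
        (ℤₚ.<-≤-trans 0<∑ (subst (f zero + ∑ (f ∘ suc) ≤_) (ℤₚ.+-identityˡ _)
          (ℤₚ.+-monoˡ-≤ (∑ (f ∘ suc)) (ℤₚ.≮⇒≥ 0≮f₀))))
  ...   | k , 0<fk = suc k , 0<fk

  ∑-∣ : ∀ c {f : Fin n → ℤ} → (∀ k → c ∣ f k) → c ∣ ∑ f
  ∑-∣ {zero}  c h = divides (+ 0) refl
  ∑-∣ {suc n} c h = ∣m∣n⇒∣m+n (h zero) (∑-∣ c (h ∘ suc))

  -- By symmetry the off-diagonal entries contribute twice the sum over one triangle, so
  -- divisibility by `c` is enough for them. This yields divisibility of norms in the invariant
  -- form.
  ∑∑-symmetric-∣ : ∀ c (f : Fin n → Fin n → ℤ) → (∀ j k → f j k ≡ f k j) →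
                   (∀ j → + 2 * c ∣ f j j) → (∀ j k → c ∣ f j k) → + 2 * c ∣ ∑ (λ j → ∑ (f j))
  ∑∑-symmetric-∣ {zero}  c f symf hd h = divides (+ 0) refl
  ∑∑-symmetric-∣ {suc n} c f symf hd h = subst (+ 2 * c ∣_) (sym split)
    (∣m∣n⇒∣m+n (∣m∣n⇒∣m+n (hd zero) (*-monoʳ-∣ (+ 2) (∑-∣ c (h zero ∘ suc))))
      (∑∑-symmetric-∣ c (λ j k → f (suc j) (suc k)) (λ j k → symf (suc j) (suc k))
         (hd ∘ suc) (λ j k → h (suc j) (suc k))))
    where
    row  = ∑ (f zero ∘ suc)
    rest = ∑ (λ j → ∑ (λ k → f (suc j) (suc k)))
    regroup : ∀ x y z → x + y + (y + z) ≡ x + + 2 * y + z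
    regroup = solve-∀
    split : ∑ (λ j → ∑ (f j)) ≡ f zero zero + + 2 * row + rest
    split = trans
      (cong (λ t → f zero zero + row + t)
        (trans (∑-+ (λ j → f (suc j) zero) (λ j → ∑ (λ k → f (suc j) (suc k))))
               (cong (_+ rest) (∑-cong (λ j → symf (suc j) zero)))))
      (regroup (f zero zero) row rest)

  ∑-nonPos : {f : Fin n → ℤ} → (∀ k → f k ≤ + 0) → ∑ f ≤ + 0
  ∑-nonPos {zero}  h = ℤₚ.≤-refl
  ∑-nonPos {suc n} h = ℤₚ.+-mono-≤ (h zero) (∑-nonPos (h ∘ suc))

  ∣⇒≤ : ∀ {c a} → + 0 < c → + 0 < a → c ∣ a → c ≤ a
  ∣⇒≤ {c} {a} 0<c 0<a (divides q eq) = subst (c ≤_) (sym eq)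
    (subst (_≤ q * c) (ℤₚ.*-identityˡ c)
      (ℤₚ.*-monoʳ-≤-nonNeg c {{ℤ.nonNegative (ℤₚ.<⇒≤ 0<c)}} (0<⇒1≤ 0<q)))
    where
    0<q : + 0 < q
    0<q = 0<-*⁻¹ (ℤₚ.<⇒≤ 0<c) (subst (+ 0 <_) (trans eq (ℤₚ.*-comm q c)) 0<a)

  positive-part : ℤ → ℤ
  positive-part (+ m)    = + m
  positive-part -[1+ m ] = + 0

  positive-part-nonNeg : ∀ a → + 0 ≤ positive-part a
  positive-part-nonNeg (+ m)    = +≤+ ℕ.z≤n
  positive-part-nonNeg -[1+ m ] = ℤₚ.≤-refl

  positive-part-∣ : ∀ c a b → c ∣ a * b → c ∣ positive-part a * b
  positive-part-∣ c (+ m)    b c∣ab = c∣ab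
  positive-part-∣ c -[1+ m ] b _    = divides (+ 0) refl

  positive-part-pos : ∀ {a} → + 0 < a → positive-part a ≢ + 0
  positive-part-pos (+<+ (ℕ.s≤s _)) ()

  positive-part-split : ∀ a → a ≡ + 1 * positive-part a + - + 1 * positive-part (- a)
  positive-part-split (+ zero)  = refl
  positive-part-split (+ suc m) = simp (+ suc m)
    where
    simp : ∀ a → a ≡ + 1 * a + - + 1 * + 0
    simp = solve-∀
  positive-part-split -[1+ m ]  = simp (+ suc m)
    where
    simp : ∀ a → - a ≡ + 1 * + 0 + - + 1 * a
    simp = solve-∀

  positive-part-disjoint : ∀ a c → positive-part a * c * positive-part (- a) ≡ + 0
  positive-part-disjoint (+ zero)  c = ℤₚ.*-zeroʳ (+ 0 * c)
  positive-part-disjoint (+ suc m) c = ℤₚ.*-zeroʳ (+ suc m * c)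
  positive-part-disjoint -[1+ m ]  c = refl

  ≥0∧*≡1⇒≡1 : ∀ {a} b → + 0 ≤ a → a * b ≡ + 1 → a ≡ + 1
  ≥0∧*≡1⇒≡1 {a} b (+≤+ {n = m} _) ab≡1 = cong +_
    (ℕₚ.m*n≡1⇒m≡1 m ℤ.∣ b ∣ (trans (sym (ℤₚ.abs-* (+ m) b)) (cong ℤ.∣_∣ ab≡1)))

  ∑-nonNeg-≡0 : {f : Fin n → ℤ} → (∀ k → + 0 ≤ f k) → ∑ f ≤ + 0 → ∀ k → f k ≡ + 0
  ∑-nonNeg-≡0 {suc n} {f} h ∑≤0 = λ where
    zero    → ℤₚ.≤-antisym (ℤₚ.≤-trans (subst (_≤ ∑ f) (ℤₚ.+-identityʳ (f zero))
                (ℤₚ.+-monoʳ-≤ (f zero) (∑-nonNeg (h ∘ suc)))) ∑≤0) (h zero)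
    (suc k) → ∑-nonNeg-≡0 (h ∘ suc) (ℤₚ.≤-trans (subst (_≤ ∑ f) (ℤₚ.+-identityˡ (∑ (f ∘ suc)))
                (ℤₚ.+-monoˡ-≤ (∑ (f ∘ suc)) (h zero))) ∑≤0) k

  -- Parity: two nonzero values among -1, 0, 1 have an even sum. Applied to coefficients at `i`, it
  -- places one of two roots in Δ(0).
  unit-sum : ∀ a b → - + 1 ≤ a → a ≤ + 1 → - + 1 ≤ b → b ≤ + 1 →
             (a + b ≡ + 1 ⊎ a + b ≡ - + 1) → a ≡ + 0 ⊎ b ≡ + 0
  unit-sum (+ 0) b _ _ _ _ _ = inj₁ refl
  unit-sum (+ suc _) (+ 0) _ _ _ _ _ = inj₂ refl
  unit-sum -[1+ _ ] (+ 0) _ _ _ _ _ = inj₂ refl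
  unit-sum (+ 1) (+ 1) _ _ _ _ (inj₁ ())
  unit-sum (+ 1) (+ 1) _ _ _ _ (inj₂ ())
  unit-sum (+ 1) -[1+ 0 ] _ _ _ _ (inj₁ ())
  unit-sum (+ 1) -[1+ 0 ] _ _ _ _ (inj₂ ())
  unit-sum -[1+ 0 ] (+ 1) _ _ _ _ (inj₁ ())
  unit-sum -[1+ 0 ] (+ 1) _ _ _ _ (inj₂ ())
  unit-sum -[1+ 0 ] -[1+ 0 ] _ _ _ _ (inj₁ ())
  unit-sum -[1+ 0 ] -[1+ 0 ] _ _ _ _ (inj₂ ())
  unit-sum (+ suc (suc _)) _ _ (+≤+ (ℕ.s≤s ())) _ _ _
  unit-sum -[1+ suc _ ] _ (-≤- ()) _ _ _ _
  unit-sum (+ 1) (+ suc (suc _)) _ _ _ (+≤+ (ℕ.s≤s ())) _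
  unit-sum (+ 1) -[1+ suc _ ] _ _ (-≤- ()) _ _
  unit-sum -[1+ 0 ] (+ suc (suc _)) _ _ _ (+≤+ (ℕ.s≤s ())) _
  unit-sum -[1+ 0 ] -[1+ suc _ ] _ _ (-≤- ()) _ _

  0≤∧≤1 : ∀ {a} → + 0 ≤ a → a ≤ + 1 → a ≡ + 0 ⊎ a ≡ + 1
  0≤∧≤1 {+ 0}           _ _ = inj₁ refl
  0≤∧≤1 {+ 1}           _ _ = inj₂ refl
  0≤∧≤1 {+ suc (suc _)} _ (+≤+ (ℕ.s≤s ()))

open IntegerLemmas

-- Nonnegative integer vectors below a given bound.

box : ∀ {n} → Vec ℤ n → List (Vec ℤ n)
box Vec.[]        = Vec.[] ∷ []
box (t Vec.∷ ts) = List.cartesianProductWith Vec._∷_ (List.map +_ (List.upTo (suc ℤ.∣ t ∣))) (box ts)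

∈-box : ∀ {n} (t v : Vec ℤ n) → (∀ k → + 0 ≤ lookup v k) → (∀ k → lookup v k ≤ lookup t k) → v ∈ box t
∈-box Vec.[]       Vec.[]       _  _  = here refl
∈-box (t Vec.∷ ts) (x Vec.∷ xs) lo hi =
  ∈-cartesianProductWith⁺ Vec._∷_ (coordinate (lo zero) (hi zero)) (∈-box ts xs (lo ∘ suc) (hi ∘ suc))
  where
  coordinate : + 0 ≤ x → x ≤ t → x ∈ List.map +_ (List.upTo (suc ℤ.∣ t ∣))
  coordinate (+≤+ _) (+≤+ m≤n) = ∈-map⁺ +_ (∈-upTo⁺ (ℕ.s≤s m≤n))

lookup-ext : ∀ {n} {x y : Vec ℤ n} → (∀ k → lookup x k ≡ lookup y k) → x ≡ y
lookup-ext {x = x} {y} h =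
  trans (sym (Vecₚ.tabulate∘lookup x)) (trans (Vecₚ.tabulate-cong h) (Vecₚ.tabulate∘lookup y))

-- The invariant form and the action of words on the root lattice.

module Form {n : ℕ} (A : Matrix n) (C : IsSimpleCartan A) (i : Fin n) where
  open RS A i
  open import Data.Integer using (_+_)
  open IsSimpleCartan C

  D : Fin n → ℤ
  D j = + d j

  0<D : ∀ j → + 0 < D j
  0<D j = +<+ (d-pos j)

  e-same : ∀ k → lookup (e k) k ≡ + 1
  e-same k = trans (Vecₚ.lookup∘tabulate _ k) lem
    where
    lem : (if ⌊ k Fin.≟ k ⌋ then + 1 else + 0) ≡ + 1
    lem with k Fin.≟ k
    ... | yes _   = refl
    ... | no  k≢k = ⊥-elim (k≢k refl)

  e-other : ∀ {k l} → k ≢ l → lookup (e k) l ≡ + 0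
  e-other {k} {l} k≢l = trans (Vecₚ.lookup∘tabulate _ l) lem
    where
    lem : (if ⌊ k Fin.≟ l ⌋ then + 1 else + 0) ≡ + 0
    lem with k Fin.≟ l
    ... | yes k≡l = ⊥-elim (k≢l k≡l)
    ... | no  _   = refl

  e-nonNeg : ∀ k l → + 0 ≤ lookup (e k) l
  e-nonNeg k l with k Fin.≟ l
  ... | yes refl = subst (+ 0 ≤_) (sym (e-same k)) (+≤+ ℕ.z≤n)
  ... | no  k≢l  = ℤₚ.≤-reflexive (sym (e-other k≢l))

  -- A coordinatewise relation z = a x + b y, so that linearity of `pair`, `B`, `height` and `act`
  -- can be stated without operations of vector addition and scaling.
  record LinComb (a : ℤ) (x : V) (b : ℤ) (y z : V) : Set where
    constructor lin
    field coord : ∀ k → lookup z k ≡ a * lookup x k + b * lookup y k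
  open LinComb

  pair-lin : ∀ {a x b y z} → LinComb a x b y z → ∀ j → pair z j ≡ a * pair x j + b * pair y j
  pair-lin {a} {x} {b} {y} lc j =
    trans (∑-cong (λ k → trans (cong (_* A j k) (coord lc k)) (distr a (lookup x k) b (lookup y k) (A j k))))
          (∑-lin a (λ k → lookup x k * A j k) b (λ k → lookup y k * A j k))
    where
    distr : ∀ a x b y c → (a * x + b * y) * c ≡ a * (x * c) + b * (y * c)
    distr = solve-∀

  -- The invariant symmetric form, normalised by (α_j , α_j) = 2 d_j.
  B : V → V → ℤ
  B x y = ∑ (λ j → lookup x j * D j * pair y j)

  B-linˡ : ∀ {a x b y z} → LinComb a x b y z → ∀ u → B z u ≡ a * B x u + b * B y u
  B-linˡ {a} {x} {b} {y} lc u =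
    trans (∑-cong (λ j → trans (cong (λ t → t * D j * pair u j) (coord lc j))
                               (distr a (lookup x j) b (lookup y j) (D j) (pair u j))))
          (∑-lin a (λ j → lookup x j * D j * pair u j) b (λ j → lookup y j * D j * pair u j))
    where
    distr : ∀ a x b y c p → (a * x + b * y) * c * p ≡ a * (x * c * p) + b * (y * c * p)
    distr = solve-∀

  B-expand : ∀ x y → B x y ≡ ∑ (λ j → ∑ (λ k → lookup x j * (D j * A j k) * lookup y k))
  B-expand x y = ∑-cong (λ j → trans (sym (∑-*ˡ (lookup x j * D j) (λ k → lookup y k * A j k)))
                   (∑-cong (λ k → regroup (lookup x j) (D j) (lookup y k) (A j k))))
    where
    regroup : ∀ x c y a → x * c * (y * a) ≡ x * (c * a) * y
    regroup = solve-∀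

  B-sym : ∀ x y → B x y ≡ B y x
  B-sym x y = trans (B-expand x y) (trans (∑-swap (λ j k → lookup x j * (D j * A j k) * lookup y k)) (trans
    (∑-cong (λ k → ∑-cong (λ j → trans (cong (λ t → lookup x j * t * lookup y k) (symm j k))
                                        (flip (lookup x j) (D k * A k j) (lookup y k)))))
    (sym (B-expand y x))))
    where
    flip : ∀ x c y → x * c * y ≡ y * c * x
    flip = solve-∀

  B-linʳ : ∀ {a x b y z} → LinComb a x b y z → ∀ u → B u z ≡ a * B u x + b * B u y
  B-linʳ {a} {x} {b} {y} {z} lc u =
    trans (B-sym u z) (trans (B-linˡ lc u) (cong₂ (λ p q → a * p + b * q) (B-sym x u) (B-sym y u)))

  B-quad : ∀ {a x b y z} → LinComb a x b y z →
           B z z ≡ a * a * B x x + + 2 * (a * b) * B x y + b * b * B y y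
  B-quad {a} {x} {b} {y} {z} lc = trans (B-linˡ lc z) (trans
    (cong₂ (λ p q → a * p + b * q) (B-linʳ lc x) (trans (B-linʳ lc y) (cong (λ t → a * t + b * B y y) (B-sym y x))))
    (expand a b (B x x) (B x y) (B y y)))
    where
    expand : ∀ a b p q r → a * (a * p + b * q) + b * (a * q + b * r) ≡
             a * a * p + + 2 * (a * b) * q + b * b * r
    expand = solve-∀

  B-eˡ : ∀ j y → B (e j) y ≡ D j * pair y j
  B-eˡ j y = trans (∑-single j (λ k j≢k → cong (λ t → t * D k * pair y k) (e-other j≢k)))
                   (trans (cong (λ t → t * D j * pair y j) (e-same j))
                          (cong (_* pair y j) (ℤₚ.*-identityˡ (D j))))

  pair-e : ∀ k j → pair (e k) j ≡ A j k
  pair-e k j = trans (∑-single k (λ l k≢l → cong (_* A j l) (e-other k≢l)))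
                     (trans (cong (_* A j k) (e-same k)) (ℤₚ.*-identityˡ _))

  B-e-e : ∀ j → B (e j) (e j) ≡ + 2 * D j
  B-e-e j = trans (B-eˡ j (e j)) (trans (cong (D j *_) (trans (pair-e j j) (diag j))) (ℤₚ.*-comm (D j) (+ 2)))

  B-positive : ∀ x k → lookup x k ≢ + 0 → + 0 < B x x
  B-positive x k xk≢0 = subst (+ 0 <_) (sym (B-expand x x)) (posdef (lookup x) (k , xk≢0))

  s-lin-coord : ∀ j v k → lookup (s j v) k ≡ + 1 * lookup v k + - pair v j * lookup (e j) k
  s-lin-coord j v k = trans (Vecₚ.lookup-zipWith _-_ k v _)
    (trans (cong (λ t → lookup v k - t) (Vecₚ.lookup-map k (pair v j *_) (e j)))
           (regroup (lookup v k) (pair v j) (lookup (e j) k)))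
    where
    regroup : ∀ a p t → a - p * t ≡ + 1 * a + - p * t
    regroup = solve-∀

  s-lin : ∀ j v → LinComb (+ 1) v (- pair v j) (e j) (s j v)
  s-lin j v = lin (s-lin-coord j v)

  s-same : ∀ j v → lookup (s j v) j ≡ lookup v j - pair v j
  s-same j v = trans (s-lin-coord j v j) (trans (cong (λ t → + 1 * lookup v j + - pair v j * t) (e-same j))
                                          (simp (lookup v j) (pair v j)))
    where
    simp : ∀ a p → + 1 * a + - p * + 1 ≡ a - p
    simp = solve-∀

  s-other : ∀ {j k} v → j ≢ k → lookup (s j v) k ≡ lookup v k
  s-other {j} {k} v j≢k = trans (s-lin-coord j v k)
    (trans (cong (λ t → + 1 * lookup v k + - pair v j * t) (e-other j≢k)) (simp (lookup v k) (pair v j)))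
    where
    simp : ∀ a p → + 1 * a + - p * + 0 ≡ a
    simp = solve-∀

  -- With p and q the pairings of x and y with the j-th simple coroot, the corrections are twice -p
  -- q d_j and once 2 p q d_j, and they cancel.
  B-s : ∀ j x y → B (s j x) (s j y) ≡ B x y
  B-s j x y = trans (B-linˡ (s-lin j x) (s j y)) (trans
    (cong₂ (λ p q → + 1 * p + - pair x j * q)
      (trans (B-linʳ (s-lin j y) x) (cong (λ t → + 1 * B x y + - pair y j * t) (trans (B-sym x (e j)) (B-eˡ j x))))
      (trans (B-linʳ (s-lin j y) (e j)) (cong₂ (λ p q → + 1 * p + - pair y j * q) (B-eˡ j y) (B-e-e j))))
    (simp (B x y) (pair x j) (pair y j) (D j)))
    where
    simp : ∀ b p q c → + 1 * (+ 1 * b + - q * (c * p)) + - p * (+ 1 * (c * q) + - q * (+ 2 * c)) ≡ b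
    simp = solve-∀

  s-e : ∀ j → s j (e j) ≡ map -_ (e j)
  s-e j = lookup-ext (λ k → trans (s-lin-coord j (e j) k)
    (trans (cong (λ t → + 1 * lookup (e j) k + - t * lookup (e j) k) (trans (pair-e j j) (diag j)))
      (trans (simp (lookup (e j) k)) (sym (Vecₚ.lookup-map k -_ (e j))))))
    where
    simp : ∀ a → + 1 * a + - (+ 2) * a ≡ - a
    simp = solve-∀

  s-preserves-lin : ∀ {a x b y z} j → LinComb a x b y z → LinComb a (s j x) b (s j y) (s j z)
  s-preserves-lin {a} {x} {b} {y} {z} j lc = lin λ k → trans (s-lin-coord j z k) (trans
    (cong₂ (λ p q → + 1 * p + - q * lookup (e j) k) (coord lc k) (pair-lin lc j))
    (trans (regroup a (lookup x k) b (lookup y k) (pair x j) (pair y j) (lookup (e j) k))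
      (sym (cong₂ (λ p q → a * p + b * q) (s-lin-coord j x k) (s-lin-coord j y k)))))
    where
    regroup : ∀ a x b y p q t → + 1 * (a * x + b * y) + - (a * p + b * q) * t ≡
              a * (+ 1 * x + - p * t) + b * (+ 1 * y + - q * t)
    regroup = solve-∀

  act-lin : ∀ {a x b y z} w → LinComb a x b y z → LinComb a (act w x) b (act w y) (act w z)
  act-lin []      lc = lc
  act-lin (j ∷ w) lc = s-preserves-lin j (act-lin w lc)

  neg-lin : ∀ x → LinComb (- + 1) x (+ 0) x (map -_ x)
  neg-lin x = lin λ k → trans (Vecₚ.lookup-map k -_ x) (regroup (lookup x k))
    where
    regroup : ∀ a → - a ≡ - + 1 * a + + 0 * a
    regroup = solve-∀

  lin-neg : ∀ {x z} → LinComb (- + 1) x (+ 0) x z → z ≡ map -_ x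
  lin-neg {x} lc = lookup-ext (λ k → trans (coord lc k) (sym (coord (neg-lin x) k)))

  act-neg : ∀ w x → act w (map -_ x) ≡ map -_ (act w x)
  act-neg w x = lin-neg (act-lin w (neg-lin x))

  neg-involutive : (x : V) → map -_ (map -_ x) ≡ x
  neg-involutive x = lookup-ext (λ k → trans (Vecₚ.lookup-map k -_ (map -_ x))
    (trans (cong -_ (Vecₚ.lookup-map k -_ x)) (ℤₚ.neg-involutive (lookup x k))))

  act-B : ∀ w x y → B (act w x) (act w y) ≡ B x y
  act-B []      x y = refl
  act-B (j ∷ w) x y = trans (B-s j (act w x) (act w y)) (act-B w x y)

  -- The matrix of the action has the images of the simple roots as columns. Signs of `act w x` can
  -- then be read off from signs on the simple roots.
  act-sum : ∀ w x l → lookup (act w x) l ≡ ∑ (λ k → lookup x k * lookup (act w (e k)) l)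
  act-sum [] x l = sym (trans
    (∑-single l (λ k l≢k → trans (cong (lookup x k *_) (e-other (l≢k ∘ sym))) (ℤₚ.*-zeroʳ (lookup x k))))
    (trans (cong (lookup x l *_) (e-same l)) (ℤₚ.*-identityʳ (lookup x l))))
  act-sum (j ∷ w) x l = trans (s-lin-coord j (act w x) l) (trans
    (cong₂ (λ p q → + 1 * p + - q * lookup (e j) l) (act-sum w x l) pair-sum)
    (trans (regroup (∑ (λ k → lookup x k * M k l)) (∑ (λ k → lookup x k * pair (act w (e k)) j)) (lookup (e j) l))
    (trans (sym (∑-lin (+ 1) (λ k → lookup x k * M k l) (- lookup (e j) l) (λ k → lookup x k * pair (act w (e k)) j)))
      (∑-cong (λ k → trans (factor (lookup x k) (M k l) (lookup (e j) l) (pair (act w (e k)) j))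
        (cong (lookup x k *_) (sym (s-lin-coord j (act w (e k)) l))))))))
    where
    M : Fin n → Fin n → ℤ
    M k m = lookup (act w (e k)) m
    pair-sum : pair (act w x) j ≡ ∑ (λ k → lookup x k * pair (act w (e k)) j)
    pair-sum = trans (∑-cong (λ m → trans (cong (_* A j m) (act-sum w x m))
                       (sym (∑-*ʳ (A j m) (λ k → lookup x k * M k m)))))
      (trans (∑-swap (λ m k → lookup x k * M k m * A j m))
        (∑-cong (λ k → trans (∑-cong (λ m → ℤₚ.*-assoc (lookup x k) (M k m) (A j m)))
                              (∑-*ˡ (lookup x k) (λ m → M k m * A j m)))))
    regroup : ∀ a b t → + 1 * a + - b * t ≡ + 1 * a + - t * b
    regroup = solve-∀
    factor : ∀ x m t p → + 1 * (x * m) + - t * (x * p) ≡ x * (+ 1 * m + - p * t)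
    factor = solve-∀

  act-++ : ∀ w u x → act (w ++ u) x ≡ act w (act u x)
  act-++ []      u x = refl
  act-++ (j ∷ w) u x = cong (s j) (act-++ w u x)

  s-involutive : ∀ j x → s j (s j x) ≡ x
  s-involutive j x = lookup-ext (λ k → trans (s-lin-coord j (s j x) k)
    (trans (cong₂ (λ p q → + 1 * p + - q * lookup (e j) k) (s-lin-coord j x k) (pair-lin (s-lin j x) j))
    (trans (cong (λ t → + 1 * (+ 1 * lookup x k + - pair x j * lookup (e j) k)
                        + - (+ 1 * pair x j + - pair x j * t) * lookup (e j) k)
                 (trans (pair-e j j) (diag j)))
      (simp (lookup x k) (pair x j) (lookup (e j) k)))))
    where
    simp : ∀ a p t → + 1 * (+ 1 * a + - p * t) + - (+ 1 * p + - p * + 2) * t ≡ a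
    simp = solve-∀

  -- Simple reflections are involutions, so the reversed word represents the inverse element.
  act-reverseˡ : ∀ w x → act (reverse w) (act w x) ≡ x
  act-reverseˡ []      x = refl
  act-reverseˡ (j ∷ w) x = trans (cong (λ u → act u (s j (act w x))) (Listₚ.unfold-reverse j w))
    (trans (act-++ (reverse w) (j ∷ []) _)
      (trans (cong (act (reverse w)) (s-involutive j (act w x))) (act-reverseˡ w x)))

  act-reverseʳ : ∀ w x → act w (act (reverse w) x) ≡ x
  act-reverseʳ w x = trans (cong (λ u → act u (act (reverse w) x)) (sym (Listₚ.reverse-involutive w)))
                           (act-reverseˡ (reverse w) x)

-- Arithmetic characterisation of roots and their signs.

module Roots {n : ℕ} (A : Matrix n) (C : IsSimpleCartan A) (i : Fin n) where
  open RS A i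
  open import Data.Integer using (_+_)
  open IsSimpleCartan C
  open Form A C i
  open LinComb

  NonNeg : V → Set
  NonNeg x = ∀ k → + 0 ≤ lookup x k

  NonPos : V → Set
  NonPos x = ∀ k → lookup x k ≤ + 0

  neg-NonPos : ∀ x → NonPos x → NonNeg (map -_ x)
  neg-NonPos x h k = subst (+ 0 ≤_) (sym (Vecₚ.lookup-map k -_ x)) (ℤₚ.neg-mono-≤ (h k))

  NonNeg-neg : ∀ x → NonNeg (map -_ x) → NonPos x
  NonNeg-neg x h k = ℤₚ.neg-cancel-≤ (subst (+ 0 ≤_) (Vecₚ.lookup-map k -_ x) (h k))

  Integral : Fin n → V → Set
  Integral j v = ∀ k → D j ∣ lookup v k * D k

  -- The second condition says that v / d_j, the coroot of v when (v , v) = 2 d_j,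
  -- lies in the coroot lattice.
  record RootLike (j : Fin n) (v : V) : Set where
    constructor rootLike
    field
      norm     : B v v ≡ + 2 * D j
      integral : Integral j v

  e-RootLike : ∀ j → RootLike j (e j)
  e-RootLike j = rootLike (B-e-e j) integral
    where
    integral : Integral j (e j)
    integral k with j Fin.≟ k
    ... | yes refl = divides (+ 1) (cong (_* D j) (e-same j))
    ... | no  j≢k  = divides (+ 0) (cong (_* D k) (e-other j≢k))

  ∣D*pair : ∀ {j v} → Integral j v → ∀ l → D j ∣ D l * pair v l
  ∣D*pair {j} {v} integral l = subst (D j ∣_) (∑-*ˡ (D l) (λ m → lookup v m * A l m))
    (∑-∣ (D j) λ m → subst (D j ∣_)
      (trans (regroup (lookup v m) (D m) (A m l))
        (trans (cong (lookup v m *_) (symm m l)) (swap (lookup v m) (D l) (A l m))))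
      (∣m⇒∣m*n (A m l) (integral m)))
    where
    regroup : ∀ x c a → x * c * a ≡ x * (c * a)
    regroup = solve-∀
    swap : ∀ x c a → x * (c * a) ≡ c * (x * a)
    swap = solve-∀

  ∣B : ∀ {j v} → Integral j v → ∀ u → D j ∣ B u v
  ∣B {j} {v} integral u = ∑-∣ (D j) λ l → subst (D j ∣_)
    (sym (ℤₚ.*-assoc (lookup u l) (D l) (pair v l))) (∣n⇒∣m*n (lookup u l) (∣D*pair {v = v} integral l))

  s-RootLike : ∀ {j v} l → RootLike j v → RootLike j (s l v)
  s-RootLike {j} {v} l (rootLike norm integral) = rootLike (trans (B-s l v v) norm) integral′
    where
    distr : ∀ a p c → a * c - c * p ≡ (a - p) * c
    distr = solve-∀
    integral′ : Integral j (s l v)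
    integral′ k with l Fin.≟ k
    ... | yes refl = subst (D j ∣_)
      (trans (distr (lookup v l) (pair v l) (D l)) (cong (_* D l) (sym (s-same l v))))
      (∣m∣n⇒∣m-n (integral l) (∣D*pair {v = v} integral l))
    ... | no  l≢k  = subst (λ t → D j ∣ t * D k) (sym (s-other v l≢k)) (integral k)

  act-RootLike : ∀ {j v} w → RootLike j v → RootLike j (act w v)
  act-RootLike []      r = r
  act-RootLike (l ∷ w) r = s-RootLike l (act-RootLike w r)

  -- In the expansion of the norm as a symmetric double sum, integrality makes the diagonal terms 2
  -- d_l x_l x_l divisible by 2 d_j and all other terms divisible by d_j.
  2D∣B : ∀ {j u} → Integral j u → + 2 * D j ∣ B u u
  2D∣B {j} {u} integral = subst (+ 2 * D j ∣_) (sym (B-expand u u))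
    (∑∑-symmetric-∣ (D j) (λ l k → x l * (D l * A l k) * x k)
      (λ l k → trans (cong (λ t → x l * t * x k) (symm l k)) (flip (x l) (D k * A k l) (x k)))
      (λ l → subst (+ 2 * D j ∣_)
        (trans (double (x l) (D l)) (cong (λ t → x l * (D l * t) * x l) (sym (diag l))))
        (*-monoʳ-∣ (+ 2) (∣m⇒∣m*n (x l) (integral l))))
      (λ l k → subst (D j ∣_) (regroup (x l) (D l) (A l k) (x k))
        (∣m⇒∣m*n (A l k * x k) (integral l))))
    where
    x = lookup u
    flip : ∀ x c y → x * c * y ≡ y * c * x
    flip = solve-∀
    double : ∀ x c → + 2 * (x * c * x) ≡ x * (c * + 2) * x
    double = solve-∀
    regroup : ∀ x c a y → x * c * (a * y) ≡ x * (c * a) * y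
    regroup = solve-∀

  0<2D : ∀ j → + 0 < + 2 * D j
  0<2D j = 0<-* {+ 2} (+<+ (ℕ.s≤s ℕ.z≤n)) (0<D j)

  private
    module Parts (v : V) where
      v⁺ v⁻ : V
      v⁺ = map positive-part v
      v⁻ = map (λ a → positive-part (- a)) v

      lookup⁺ : ∀ k → lookup v⁺ k ≡ positive-part (lookup v k)
      lookup⁺ k = Vecₚ.lookup-map k positive-part v

      lookup⁻ : ∀ k → lookup v⁻ k ≡ positive-part (- lookup v k)
      lookup⁻ k = Vecₚ.lookup-map k (λ a → positive-part (- a)) v

      split : LinComb (+ 1) v⁺ (- + 1) v⁻ v
      split = lin λ k → trans (positive-part-split (lookup v k))
        (sym (cong₂ (λ p q → + 1 * p + - + 1 * q) (lookup⁺ k) (lookup⁻ k)))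

      integral⁺ : ∀ {j} → Integral j v → Integral j v⁺
      integral⁺ {j} h k = subst (λ t → D j ∣ t * D k) (sym (lookup⁺ k))
        (positive-part-∣ (D j) (lookup v k) (D k) (h k))

      integral⁻ : ∀ {j} → Integral j v → Integral j v⁻
      integral⁻ {j} h k = subst (λ t → D j ∣ t * D k) (sym (lookup⁻ k))
        (positive-part-∣ (D j) (- lookup v k) (D k)
          (subst (D j ∣_) (ℤₚ.neg-distribˡ-* (lookup v k) (D k)) (∣m⇒∣-m (h k))))

      term : Fin n → Fin n → ℤ
      term j k = positive-part (lookup v j) * (D j * A j k) * positive-part (- lookup v k)

      -- Diagonal terms vanish because the two parts have disjoint supports; off the diagonal the
      -- Cartan entries are nonpositive.
      term≤0 : ∀ j k → term j k ≤ + 0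
      term≤0 j k with j Fin.≟ k
      ... | yes refl = ℤₚ.≤-reflexive (positive-part-disjoint (lookup v j) (D j * A j j))
      ... | no  j≢k  = ℤₚ.neg-cancel-≤ (subst (+ 0 ≤_)
        (regroup (positive-part (lookup v j)) (D j) (A j k) (positive-part (- lookup v k)))
        (0≤-* (0≤-* (positive-part-nonNeg (lookup v j))
                    (0≤-* (ℤₚ.<⇒≤ (0<D j)) (ℤₚ.neg-mono-≤ (offdiag j k j≢k))))
              (positive-part-nonNeg (- lookup v k))))
        where
        regroup : ∀ x c a y → x * (c * - a) * y ≡ - (x * (c * a) * y)
        regroup = solve-∀

      B⁺⁻≤0 : B v⁺ v⁻ ≤ + 0
      B⁺⁻≤0 = subst (_≤ + 0)
        (sym (trans (B-expand v⁺ v⁻) (∑-cong λ j → ∑-cong λ k →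
          cong₂ (λ p q → p * (D j * A j k) * q) (lookup⁺ j) (lookup⁻ k))))
        (∑-nonPos λ j → ∑-nonPos (term≤0 j))

  -- For v = v⁺ - v⁻ with both parts nonzero, 2 d_j = (v , v) ≥ (v⁺ , v⁺) + (v⁻ , v⁻) ≥ 4 d_j,
  -- since both norms are positive multiples of 2 d_j.
  RootLike-no-mixed-signs : ∀ {j v} → RootLike j v → ∀ {k l} →
                            + 0 < lookup v k → lookup v l < + 0 → ⊥
  RootLike-no-mixed-signs {j} {v} (rootLike norm integral) {k} {l} 0<vk vl<0 =
    ℤₚ.<⇒≱ (0<2D j) (ℤₚ.neg-cancel-≤ (subst (+ 0 ≤_) total
      (0≤-+ (0≤-+ (ℤₚ.i≤j⇒0≤j-i 2D≤⁺) (ℤₚ.i≤j⇒0≤j-i 2D≤⁻))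
            (0≤-* {+ 2} (+≤+ ℕ.z≤n) (ℤₚ.neg-mono-≤ B⁺⁻≤0)))))
    where
    open Parts v
    2D≤⁺ : + 2 * D j ≤ B v⁺ v⁺
    2D≤⁺ = ∣⇒≤ (0<2D j)
      (B-positive v⁺ k (λ eq → positive-part-pos 0<vk (trans (sym (lookup⁺ k)) eq)))
      (2D∣B {u = v⁺} (integral⁺ integral))
    2D≤⁻ : + 2 * D j ≤ B v⁻ v⁻
    2D≤⁻ = ∣⇒≤ (0<2D j)
      (B-positive v⁻ l (λ eq → positive-part-pos (ℤₚ.neg-mono-< vl<0) (trans (sym (lookup⁻ l)) eq)))
      (2D∣B {u = v⁻} (integral⁻ integral))
    regroup : ∀ p q r c → p - c + (q - c) + + 2 * - r ≡
              (+ 1 * + 1 * p + + 2 * (+ 1 * - + 1) * r + - + 1 * - + 1 * q) - + 2 * c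
    regroup = solve-∀
    simp : ∀ c → c - + 2 * c ≡ - c
    simp = solve-∀
    total : B v⁺ v⁺ - + 2 * D j + (B v⁻ v⁻ - + 2 * D j) + + 2 * - B v⁺ v⁻ ≡ - (+ 2 * D j)
    total = trans (regroup (B v⁺ v⁺) (B v⁻ v⁻) (B v⁺ v⁻) (+ 2 * D j))
      (trans (cong (_- + 2 * (+ 2 * D j)) (trans (sym (B-quad split)) norm)) (simp (+ 2 * D j)))

  abstract
    RootLike-sign : ∀ {j v} → RootLike j v → NonNeg v ⊎ NonNeg (map -_ v)
    RootLike-sign {j} {v} r with Finₚ.any? (λ k → lookup v k ℤₚ.<? + 0) | Finₚ.any? (λ k → + 0 ℤₚ.<? lookup v k)
    ... | no ∄neg        | _              = inj₁ λ k → ℤₚ.≮⇒≥ (λ h → ∄neg (k , h))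
    ... | yes _          | no ∄pos        = inj₂ (neg-NonPos v λ k → ℤₚ.≮⇒≥ (λ h → ∄pos (k , h)))
    ... | yes (l , vl<0) | yes (k , 0<vk) = ⊥-elim (RootLike-no-mixed-signs r 0<vk vl<0)

  -- Here v = c α_j. Integrality gives c d_j = q d_m and the norm gives c c d_j = d_m; together c q
  -- = 1, and c is nonnegative.
  single-support⇒simple : ∀ {m v} j → RootLike m v → NonNeg v →
                      (∀ k → j ≢ k → lookup v k ≡ + 0) → v ≡ e j
  single-support⇒simple {m} {v} j (rootLike norm integral) nonneg supp = lookup-ext coords
    where
    c = lookup v j
    q = quotient (integral j)
    c*D : c * D j ≡ q * D m
    c*D = _∣_.equality (integral j)
    multiple : LinComb c (e j) (+ 0) (e j) v
    multiple = lin h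
      where
      simp₁ : ∀ c → c ≡ c * + 1 + + 0 * + 1
      simp₁ = solve-∀
      simp₀ : ∀ c → + 0 ≡ c * + 0 + + 0 * + 0
      simp₀ = solve-∀
      h : ∀ k → lookup v k ≡ c * lookup (e j) k + + 0 * lookup (e j) k
      h k with j Fin.≟ k
      ... | yes refl = trans (simp₁ c) (cong (λ t → c * t + + 0 * t) (sym (e-same j)))
      ... | no  j≢k  = trans (supp k j≢k) (trans (simp₀ c) (cong (λ t → c * t + + 0 * t) (sym (e-other j≢k))))
    norm′ : c * q * (+ 2 * D m) ≡ + 1 * (+ 2 * D m)
    norm′ = trans (regroup c q (D m)) (trans (cong (λ t → c * + 2 * t) (sym c*D))
      (trans (trans (simp c (D j)) (cong (λ t → c * c * t + + 2 * (c * + 0) * t + + 0 * + 0 * t) (sym (B-e-e j))))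
      (trans (sym (B-quad multiple)) (trans norm (sym (ℤₚ.*-identityˡ _))))))
      where
      regroup : ∀ c q t → c * q * (+ 2 * t) ≡ c * + 2 * (q * t)
      regroup = solve-∀
      simp : ∀ c t → c * + 2 * (c * t) ≡
             c * c * (+ 2 * t) + + 2 * (c * + 0) * (+ 2 * t) + + 0 * + 0 * (+ 2 * t)
      simp = solve-∀
    c≡1 : c ≡ + 1
    c≡1 = ≥0∧*≡1⇒≡1 q (nonneg j)
      (ℤₚ.*-cancelʳ-≡ (c * q) (+ 1) (+ 2 * D m) {{ℤ.≢-nonZero (ℤₚ.<⇒≢ (0<2D m) ∘ sym)}} norm′)
    coords : ∀ k → lookup v k ≡ lookup (e j) k
    coords k with j Fin.≟ k
    ... | yes refl = trans c≡1 (sym (e-same j))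
    ... | no  j≢k  = trans (supp k j≢k) (sym (e-other j≢k))

  -- Heights and descent to simple roots.

  height : V → ℤ
  height v = ∑ (lookup v)

  height-lin : ∀ {a x b y z} → LinComb a x b y z → height z ≡ a * height x + b * height y
  height-lin {a} {x} {b} {y} lc = trans (∑-cong (coord lc)) (∑-lin a (lookup x) b (lookup y))

  height-e : ∀ j → height (e j) ≡ + 1
  height-e j = trans (∑-single j (λ k → e-other)) (e-same j)

  abstract
    -- The positive norm is the sum of the terms v_l d_l `pair v l`, so one of them is positive, and
    -- its factor v_l d_l is nonnegative.
    positive-pairing : ∀ {j v} → RootLike j v → NonNeg v → ∃ λ l → + 0 < pair v l
    positive-pairing {j} (rootLike norm _) nonneg
      with l , 0<t ← ∑-positive-term (subst (+ 0 <_) (sym norm) (0<2D j))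
      = l , 0<-*⁻¹ (0≤-* (nonneg l) (ℤₚ.<⇒≤ (0<D l))) 0<t

  -- Only the coordinate at `j` changes under `s j`, so the sign conditions before and after force
  -- every other coordinate to be zero.
  reflected-neg⇒simple : ∀ {m v} j → RootLike m v → NonNeg v → NonNeg (map -_ (s j v)) → v ≡ e j
  reflected-neg⇒simple {v = v} j r nonneg neg = single-support⇒simple j r nonneg
    (λ k j≢k → ℤₚ.≤-antisym (subst (_≤ + 0) (s-other v j≢k) (NonNeg-neg (s j v) neg k)) (nonneg k))

  height-s : ∀ l v → height (s l v) ≡ height v - pair v l
  height-s l v = trans (height-lin (s-lin l v))
    (trans (cong (λ t → + 1 * height v + - pair v l * t) (height-e l)) (simp (height v) (pair v l)))
    where
    simp : ∀ t p → + 1 * t + - p * + 1 ≡ t - p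
    simp = solve-∀

  height-s≤ : ∀ l v h → + 0 < pair v l → height v ≤ h → height (s l v) ≤ h - + 1
  height-s≤ l v h 0<p ht≤h = subst (_≤ h - + 1) (sym (height-s l v))
    (ℤₚ.+-mono-≤ ht≤h (ℤₚ.neg-mono-≤ (0<⇒1≤ 0<p)))

  IsRoot-act : ∀ {γ} w → IsRoot γ → IsRoot (act w γ)
  IsRoot-act w (u , k , eq) = w ++ u , k , trans (cong (act w) eq) (sym (act-++ w u (e k)))

  IsRoot-s⁻¹ : ∀ l v → IsRoot (s l v) → IsRoot v
  IsRoot-s⁻¹ l v r = subst IsRoot (s-involutive l v) (IsRoot-act (l ∷ []) r)

  -- Descent: reflecting in a simple root of positive pairing lowers the height, and the result is
  -- again nonnegative unless the vector was that simple root. The bound `h` makes the recursion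
  -- structural.
  nonNeg-RootLike⇒IsRoot : ∀ h {j v} → RootLike j v → NonNeg v → height v ≤ + h → IsRoot v
  descend : ∀ h {j v} l → RootLike j v → NonNeg v → height v ≤ + h → + 0 < pair v l →
            NonNeg (s l v) ⊎ NonNeg (map -_ (s l v)) → IsRoot v

  nonNeg-RootLike⇒IsRoot h {j} {v} r nonneg ht≤h =
    let l , 0<p = positive-pairing r nonneg
    in descend h l r nonneg ht≤h 0<p (RootLike-sign (s-RootLike l r))

  descend h l r nonneg _ _ (inj₂ neg) = [] , l , reflected-neg⇒simple l r nonneg neg
  -- The reflected vector would be nonnegative and yet have height at most -1.
  descend zero {v = v} l r _ ht≤h 0<p (inj₁ nonneg) =
    case ℤₚ.≤-trans (∑-nonNeg nonneg) (height-s≤ l v (+ 0) 0<p ht≤h) of λ ()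
  descend (suc h) {v = v} l r _ ht≤h 0<p (inj₁ nonneg) = IsRoot-s⁻¹ l v
    (nonNeg-RootLike⇒IsRoot h (s-RootLike l r) nonneg (height-s≤ l v (+ suc h) 0<p ht≤h))

  -- Since s_k negates α_k, the negative of u(α_k) is u s_k (α_k).
  IsRoot-neg : ∀ {γ} → IsRoot γ → IsRoot (map -_ γ)
  IsRoot-neg {γ} (u , k , eq) = u ∷ʳ k , k ,
    trans (cong (λ x → map -_ x) eq) (trans (sym (act-neg u (e k)))
      (trans (cong (act u) (sym (s-e k))) (sym (act-++ u (k ∷ []) (e k)))))

  abstract
    RootLike⇒IsRoot : ∀ {j v} → RootLike j v → IsRoot v
    RootLike⇒IsRoot {j} {v} r with RootLike-sign r
    ... | inj₁ nonneg = nonNeg-RootLike⇒IsRoot ℤ.∣ height v ∣ r nonneg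
                          (ℤₚ.≤-reflexive (sym (ℤₚ.0≤i⇒+∣i∣≡i (∑-nonNeg nonneg))))
    ... | inj₂ nonneg = subst IsRoot (neg-involutive v) (IsRoot-neg
      (nonNeg-RootLike⇒IsRoot ℤ.∣ height (map -_ v) ∣ (RootLike-neg r) nonneg
        (ℤₚ.≤-reflexive (sym (ℤₚ.0≤i⇒+∣i∣≡i (∑-nonNeg nonneg))))))
      where
      RootLike-neg : RootLike j v → RootLike j (map -_ v)
      RootLike-neg (rootLike norm integral) = rootLike
        (trans (B-quad (neg-lin v)) (trans (simp (B v v)) norm))
        λ k → subst (D j ∣_)
          (trans (ℤₚ.neg-distribˡ-* (lookup v k) (D k)) (cong (_* D k) (sym (Vecₚ.lookup-map k -_ v))))
          (∣m⇒∣-m (integral k))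
        where
        simp : ∀ b → - + 1 * - + 1 * b + + 2 * (- + 1 * + 0) * b + + 0 * + 0 * b ≡ b
        simp = solve-∀

  abstract
    IsRoot⇒RootLike : ∀ {v} → IsRoot v → ∃ λ j → RootLike j v
    IsRoot⇒RootLike (w , k , eq) = k , subst (RootLike k) (sym eq) (act-RootLike w (e-RootLike k))

  -- The arithmetic condition runs over finitely many indices, whereas the definition of a root
  -- quantifies over all words.
  IsRoot? : ∀ v → Dec (IsRoot v)
  IsRoot? v = map′ (λ (_ , norm , integral) → RootLike⇒IsRoot (rootLike norm integral))
    (λ r → let j , rootLike norm integral = IsRoot⇒RootLike r in j , norm , integral)
    (Finₚ.any? λ j → (B v v ℤₚ.≟ + 2 * D j) ×-dec Finₚ.all? (λ k → D j ∣? lookup v k * D k))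

  -- Signs, differences and decompositions of roots.

  e-root : ∀ k → IsRoot (e k)
  e-root k = [] , k , refl

  e-pos : ∀ k → PosRoot (e k)
  e-pos k = e-root k , e-nonNeg k

  abstract
    root-sign : ∀ {γ} → IsRoot γ → PosRoot γ ⊎ NegRoot γ
    root-sign r with RootLike-sign (proj₂ (IsRoot⇒RootLike r))
    ... | inj₁ nonneg = inj₁ (r , nonneg)
    ... | inj₂ neg    = inj₂ (IsRoot-neg r , neg)

  root-nonzero : ∀ {γ} → IsRoot γ → ¬ (∀ k → lookup γ k ≡ + 0)
  root-nonzero {γ} r zeros with IsRoot⇒RootLike r
  ... | j , rootLike norm _ = ℤₚ.<⇒≢ (0<2D j) (trans (sym (∑-zero λ k → cong (λ t → t * D k * pair γ k) (zeros k))) norm)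

  pos∧neg⇒⊥ : ∀ {γ} → PosRoot γ → NegRoot γ → ⊥
  pos∧neg⇒⊥ {γ} (r , nonneg) (_ , neg) = root-nonzero r λ k → ℤₚ.≤-antisym (NonNeg-neg γ neg k) (nonneg k)

  s-pos : ∀ {γ} j → PosRoot γ → γ ≢ e j → PosRoot (s j γ)
  s-pos j (r , nonneg) γ≢ej with root-sign (IsRoot-act (j ∷ []) r)
  ... | inj₁ pos       = pos
  ... | inj₂ (_ , neg) = ⊥-elim (γ≢ej (reflected-neg⇒simple j (proj₂ (IsRoot⇒RootLike r)) nonneg neg))

  difference : V → V → V
  difference = Vec.zipWith _-_

  difference-lin : ∀ x y → LinComb (+ 1) x (- + 1) y (difference x y)
  difference-lin x y = lin λ k → trans (Vecₚ.lookup-zipWith _-_ k x y) (regroup (lookup x k) (lookup y k))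
    where
    regroup : ∀ a b → a - b ≡ + 1 * a + - + 1 * b
    regroup = solve-∀

  -- One of the integers (μ , ν) / d_m and (μ , ν) / d_n equals 1 unless (μ - ν , μ - ν) ≤ 0.
  difference-RootLike : ∀ {m n μ ν} → RootLike m μ → RootLike n ν →
    ∀ a b → B μ ν ≡ a * D n → B μ ν ≡ b * D m → + 0 < B μ ν → μ ≢ ν → IsRoot (difference μ ν)
  difference-RootLike {m} {n} {μ} {ν} (rootLike normμ intμ) (rootLike normν intν) a b Ba Bb 0<B μ≢ν = cases
    where
    z = difference μ ν
    norm : B z z ≡ + 2 * D m - + 2 * B μ ν + + 2 * D n
    norm = trans (B-quad (difference-lin μ ν)) (trans
      (cong₂ (λ p q → + 1 * + 1 * p + + 2 * (+ 1 * - + 1) * B μ ν + - + 1 * - + 1 * q) normμ normν)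
      (simp (+ 2 * D m) (B μ ν) (+ 2 * D n)))
      where
      simp : ∀ p b q → + 1 * + 1 * p + + 2 * (+ 1 * - + 1) * b + - + 1 * - + 1 * q ≡ p - + 2 * b + q
      simp = solve-∀
    integral : ∀ c → D c ∣ D m → D c ∣ D n → Integral c z
    integral c c∣m c∣n k = subst (D c ∣_)
      (trans (distr (lookup μ k) (lookup ν k) (D k)) (cong (_* D k) (sym (Vecₚ.lookup-zipWith _-_ k μ ν))))
      (∣m∣n⇒∣m-n (∣-trans c∣m (intμ k)) (∣-trans c∣n (intν k)))
      where
      distr : ∀ a b c → a * c - b * c ≡ (a - b) * c
      distr = solve-∀
    0<a : + 0 < a
    0<a = 0<-*⁻¹ (ℤₚ.<⇒≤ (0<D n)) (subst (+ 0 <_) (trans Ba (ℤₚ.*-comm a (D n))) 0<B)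
    0<b : + 0 < b
    0<b = 0<-*⁻¹ (ℤₚ.<⇒≤ (0<D m)) (subst (+ 0 <_) (trans Bb (ℤₚ.*-comm b (D m))) 0<B)
    2D≤B : ∀ {q} c → + 0 < q → q ≢ + 1 → B μ ν ≡ q * D c → + 2 * D c ≤ B μ ν
    2D≤B c 0<q q≢1 eq = subst (+ 2 * D c ≤_) (sym eq)
      (ℤₚ.*-monoʳ-≤-nonNeg (D c) (ℤₚ.i<j⇒suc[i]≤j (ℤₚ.≤∧≢⇒< (0<⇒1≤ 0<q) (q≢1 ∘ sym))))
    cases : IsRoot z
    cases with a ℤₚ.≟ + 1 | b ℤₚ.≟ + 1
    -- When a = 1, (μ , ν) = d_n, so the difference has norm 2 d_m; moreover d_n = b d_m, so both
    -- vectors are integral for `m`. The next case is the mirror image.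
    ... | yes refl | _ = RootLike⇒IsRoot {m} (rootLike (trans norm
            (trans (cong (λ t → + 2 * D m - + 2 * t + + 2 * D n) Ba) (simp (D m) (D n))))
            (integral m ∣-refl (divides b (trans (sym (ℤₚ.*-identityˡ (D n))) (trans (sym Ba) Bb)))))
      where
      simp : ∀ p q → + 2 * p - + 2 * (+ 1 * q) + + 2 * q ≡ + 2 * p
      simp = solve-∀
    ... | no _ | yes refl = RootLike⇒IsRoot {n} (rootLike (trans norm
            (trans (cong (λ t → + 2 * D m - + 2 * t + + 2 * D n) Bb) (simp (D m) (D n))))
            (integral n (divides a (trans (sym (ℤₚ.*-identityˡ (D m))) (trans (sym Bb) Ba))) ∣-refl))
      where
      simp : ∀ p q → + 2 * p - + 2 * (+ 1 * p) + + 2 * q ≡ + 2 * q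
      simp = solve-∀
    ... | no a≢1 | no b≢1 = ⊥-elim (μ≢ν (lookup-ext equal))
      where
      regroup : ∀ p q b → b - + 2 * p + (b - + 2 * q) ≡ - (+ 2 * p - + 2 * b + + 2 * q)
      regroup = solve-∀
      Bzz≤0 : B z z ≤ + 0
      Bzz≤0 = ℤₚ.neg-cancel-≤ (subst (+ 0 ≤_) (trans (regroup (D m) (D n) (B μ ν)) (cong -_ (sym norm)))
        (0≤-+ (ℤₚ.i≤j⇒0≤j-i (2D≤B m 0<b b≢1 Bb)) (ℤₚ.i≤j⇒0≤j-i (2D≤B n 0<a a≢1 Ba))))
      equal : ∀ k → lookup μ k ≡ lookup ν k
      equal k with lookup z k ℤₚ.≟ + 0
      ... | yes zk≡0 = ℤₚ.i-j≡0⇒i≡j _ _ (trans (sym (Vecₚ.lookup-zipWith _-_ k μ ν)) zk≡0)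
      ... | no  zk≢0 = ⊥-elim (ℤₚ.<⇒≱ (B-positive z k zk≢0) Bzz≤0)

  abstract
    difference-root : ∀ {μ ν} → IsRoot μ → IsRoot ν → + 0 < B μ ν → μ ≢ ν → IsRoot (difference μ ν)
    difference-root {μ} {ν} rμ rν 0<B μ≢ν =
      let m , rlμ = IsRoot⇒RootLike rμ
          n , rlν = IsRoot⇒RootLike rν
          divides a Ba = ∣B {v = ν} (RootLike.integral rlν) μ
          divides b Bb = ∣B {v = μ} (RootLike.integral rlμ) ν
      in difference-RootLike rlμ rlν a b Ba (trans (B-sym μ ν) Bb) 0<B μ≢ν

  -- A simple root α_l of positive pairing with β can be subtracted within the root system. Were β -
  -- α_l negative, β would be supported at `l` alone and hence simple.
  nonsimple-decomposition : ∀ {β} → PosRoot β → ¬ Simple β →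
    ∃₂ λ j ν → PosRoot ν × LinComb (+ 1) β (- + 1) (e j) ν
  nonsimple-decomposition {β} (r , nonneg) nonsimple = l , ν , pos , difference-lin β (e l)
    where
    m  = proj₁ (IsRoot⇒RootLike r)
    rl = proj₂ (IsRoot⇒RootLike r)
    l  = proj₁ (positive-pairing rl nonneg)
    ν  = difference β (e l)
    0<B : + 0 < B β (e l)
    0<B = subst (+ 0 <_) (trans (sym (B-eˡ l β)) (B-sym (e l) β))
            (0<-* (0<D l) (proj₂ (positive-pairing rl nonneg)))
    simp : ∀ a → + 1 * a + - + 1 * + 0 ≡ a
    simp = solve-∀
    supp : NonNeg (map -_ ν) → ∀ k → l ≢ k → lookup β k ≡ + 0
    supp neg k l≢k = ℤₚ.≤-antisym
      (subst (_≤ + 0) (trans (coord (difference-lin β (e l)) k)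
        (trans (cong (λ t → + 1 * lookup β k + - + 1 * t) (e-other l≢k)) (simp (lookup β k))))
        (NonNeg-neg ν neg k))
      (nonneg k)
    pos : PosRoot ν
    pos = [ id , (λ (_ , neg) → ⊥-elim (nonsimple (l , single-support⇒simple l rl nonneg (supp neg)))) ]′
      (root-sign (difference-root r (e-root l) 0<B (λ eq → nonsimple (l , eq))))

unique∧set⇒length : ∀ {A : Set} {xs ys : List A} → Unique xs → Unique ys →
                    (∀ x → (x ∈ xs) ⇔ (x ∈ ys)) → length xs ≡ length ys
unique∧set⇒length u u′ h = ↭-length (∼bag⇒↭ (unique∧set⇒bag u u′ λ {x} → h x))

-- The exchange property and elements that preserve positivity.

module Weyl {n : ℕ} (A : Matrix n) (C : IsSimpleCartan A) (i : Fin n) where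
  open RS A i
  open import Data.Integer using (_+_)
  open IsSimpleCartan C
  open Form A C i
  open LinComb
  open Roots A C i

  _≟ⱽ_ : (x y : V) → Dec (x ≡ y)
  _≟ⱽ_ = Vecₚ.≡-dec ℤₚ._≟_

  -- The conjugate of s_j by w is the reflection in w(α_j). Invariance of the form gives d_j = d_m,
  -- and then equality of the coroot pairings.
  act-e-conjugates : ∀ w {j m} → act w (e j) ≡ e m → ∀ x → act w (s j x) ≡ s m (act w x)
  act-e-conjugates w {j} {m} eq x = lookup-ext λ k →
    trans (coord (act-lin w (s-lin j x)) k)
      (trans (cong₂ (λ p q → + 1 * lookup (act w x) k + - p * lookup q k) pair≡ eq)
             (sym (s-lin-coord m (act w x) k)))
    where
    D≡ : D j ≡ D m
    D≡ = ℤₚ.*-cancelˡ-≡ (+ 2) (D j) (D m)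
      (trans (sym (B-e-e j)) (trans (sym (act-B w (e j) (e j))) (trans (cong₂ B eq eq) (B-e-e m))))
    pair≡ : pair x j ≡ pair (act w x) m
    pair≡ = ℤₚ.*-cancelˡ-≡ (D j) (pair x j) (pair (act w x) m) {{ℤ.≢-nonZero (ℤₚ.<⇒≢ (0<D j) ∘ sym)}}
      (trans (sym (B-eˡ j x)) (trans (sym (act-B w (e j) x)) (trans (cong (λ t → B t (act w x)) eq)
        (trans (B-eˡ m (act w x)) (cong (_* pair (act w x) m) (sym D≡))))))

  act-injective : ∀ w {x y} → act w x ≡ act w y → x ≡ y
  act-injective w {x} {y} eq =
    trans (sym (act-reverseˡ w x)) (trans (cong (act (reverse w)) eq) (act-reverseˡ w y))

  abstract
    -- Either the tail already sends α_j to a negative root, or the head s_m turns a positive root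
    -- negative. In the latter case that root is α_m, so s_m w = w s_j and deleting the head gives
    -- `u`.
    exchange : ∀ w j → NegRoot (act w (e j)) → ∃ λ u → (w ≈W (u ∷ʳ j)) × suc (length u) ≡ length w
    exchange []      j neg = ⊥-elim (pos∧neg⇒⊥ (e-pos j) neg)
    exchange (m ∷ w) j neg with root-sign (IsRoot-act w (e-root j))
    ... | inj₂ neg′ with u , w≈ , len ← exchange w j neg′ = m ∷ u , (λ x → cong (s m) (w≈ x)) , cong suc len
    ... | inj₁ pos with act w (e j) ≟ⱽ e m
    ...   | yes eq = w , (λ x → trans (sym (act-e-conjugates w eq x)) (sym (act-++ w (j ∷ []) x))) , refl
    ...   | no neq = ⊥-elim (pos∧neg⇒⊥ (s-pos m pos neq) neg)

  act-∷ʳ-e : ∀ w j → act (w ∷ʳ j) (e j) ≡ map -_ (act w (e j))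
  act-∷ʳ-e w j = trans (act-++ w (j ∷ []) (e j)) (trans (cong (act w) (s-e j)) (act-neg w (e j)))

  length-∷ʳ : ∀ w (j : Fin n) → length (w ∷ʳ j) ≡ suc (length w)
  length-∷ʳ w j = trans (Listₚ.length-++ w) (ℕₚ.+-comm (length w) 1)

  -- If the word ends in j, its remaining part sends α_j to a negative root, so exchange lets the
  -- last letter cancel and leaves a shorter word for the same element. The recursion runs on a
  -- length bound, `u` not being a subword by construction.
  simples-positive⇒≈[] : ∀ w → (∀ j → PosRoot (act w (e j))) → w ≈W []
  simples-positive⇒≈[] w = go (length w) w ℕₚ.≤-refl
    where
    go : ∀ h w → length w ℕ.≤ h → (∀ j → PosRoot (act w (e j))) → w ≈W []
    go h w _ pos with initLast w
    go h       .[]        _   pos | []      = λ _ → refl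
    go zero    .(w ∷ʳ j) len pos | w ∷ʳ′ j with () ← subst (ℕ._≤ 0) (length-∷ʳ w j) len
    go (suc h) .(w ∷ʳ j) len pos | w ∷ʳ′ j
      with u , w≈ , len′ ← exchange w j (subst PosRoot (act-∷ʳ-e w j) (pos j))
      = λ x → trans (w∷ʳj≈u x) (go h u lenu (λ k → subst PosRoot (w∷ʳj≈u (e k)) (pos k)) x)
      where
      w∷ʳj≈u : (w ∷ʳ j) ≈W u
      w∷ʳj≈u x = trans (act-++ w (j ∷ []) x) (trans (w≈ (s j x))
        (trans (act-++ u (j ∷ []) (s j x)) (cong (act u) (s-involutive j x))))
      -- `u` is two letters shorter than `w ∷ʳ j`, so one unit of the bound is left over.
      lenu : length u ℕ.≤ h
      lenu = ℕₚ.≤-trans (ℕₚ.n≤1+n _) (subst (ℕ._≤ h) (sym len′)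
               (ℕ.s≤s⁻¹ (subst (ℕ._≤ suc h) (length-∷ʳ w j) len)))

  -- The previous criterion is applied to w times the inverse of v.
  simples-positive⇒≈W : ∀ w v → (∀ j → PosRoot (act w (act (reverse v) (e j)))) → w ≈W v
  simples-positive⇒≈W w v pos x = trans (cong (act w) (sym (act-reverseˡ v x)))
    (trans (sym (act-++ w (reverse v) (act v x)))
      (simples-positive⇒≈[] (w ++ reverse v) (λ j → subst PosRoot (sym (act-++ w (reverse v) (e j))) (pos j)) (act v x)))

  act-nonNeg : ∀ w {x} → (∀ k → lookup x k ≡ + 0 ⊎ NonNeg (act w (e k))) → NonNeg x → NonNeg (act w x)
  act-nonNeg w {x} h nonneg l = subst (+ 0 ≤_) (sym (act-sum w x l)) (∑-nonNeg term)
    where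
    term : ∀ k → + 0 ≤ lookup x k * lookup (act w (e k)) l
    term k with h k
    ... | inj₁ xk≡0 = ℤₚ.≤-reflexive (sym (cong (_* lookup (act w (e k)) l) xk≡0))
    ... | inj₂ nn   = 0≤-* (nonneg k) (nn l)

  reverse-cong : ∀ {w v} → w ≈W v → reverse w ≈W reverse v
  reverse-cong {w} {v} w≈v x = trans (cong (act (reverse w)) (sym (act-reverseʳ v x)))
    (trans (cong (act (reverse w)) (sym (w≈v (act (reverse v) x)))) (act-reverseˡ w (act (reverse v) x)))

  -- Inversion sets of reduced words.

  Reduced : Word → Set
  Reduced w = ∀ u → u ≈W w → length w ℕ.≤ length u

  reduced-tail : ∀ {m w} → Reduced (m ∷ w) → Reduced w
  reduced-tail {m} red u u≈w = ℕ.s≤s⁻¹ (red (m ∷ u) (λ x → cong (s m) (u≈w x)))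

  -- Otherwise exchange on the inverse of w produces u with inverse s_m w and fewer letters than w,
  -- contradicting reducedness.
  reduced-head-positive : ∀ {m w} → Reduced (m ∷ w) → PosRoot (act (reverse w) (e m))
  reduced-head-positive {m} {w} red with root-sign (IsRoot-act (reverse w) (e-root m))
  ... | inj₁ pos = pos
  ... | inj₂ neg with u , w≈ , len ← exchange (reverse w) m neg = ⊥-elim (ℕₚ.<-asym
        (subst (length w ℕ.<_) (Listₚ.length-reverse u) (red (reverse u) shorter))
        (ℕₚ.≤-reflexive (trans len (Listₚ.length-reverse w))))
    where
    shorter : reverse u ≈W (m ∷ w)
    shorter x = trans (sym (s-involutive m (act (reverse u) x)))
      (cong (s m) (trans (cong (λ t → act t x) (sym (Listₚ.reverse-++ u (m ∷ []))))
        (trans (sym (reverse-cong {reverse w} {u ∷ʳ m} w≈ x)) (cong (λ t → act t x) (Listₚ.reverse-involutive w)))))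

  -- Each letter s_m contributes the root sent to α_m by the letters to its right. For a reduced
  -- word this is the classical list of inversions.
  inversions : Word → List V
  inversions []      = []
  inversions (m ∷ w) = act (reverse w) (e m) ∷ inversions w

  length-inversions : ∀ w → length (inversions w) ≡ length w
  length-inversions []      = refl
  length-inversions (m ∷ w) = cong suc (length-inversions w)

  -- Among all roots, s_m changes the sign of α_m and its negative only, so the inversion set
  -- changes only at the preimage β of α_m.
  N-∷ : ∀ m w {β} → PosRoot β → act w β ≡ e m → ∀ γ → N (m ∷ w) γ ⇔ (γ ≡ β ⊎ N w γ)
  N-∷ m w {β} β-pos actβ γ = mk⇔ to from
    where
    from-e : ∀ {γ} → act w γ ≡ e m → γ ≡ β
    from-e eq = act-injective w (trans eq (sym actβ))
    from : γ ≡ β ⊎ N w γ → N (m ∷ w) γ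
    from (inj₁ refl) = β-pos , subst PosRoot
      (trans (sym (neg-involutive (e m))) (cong (λ x → map -_ x) (trans (sym (s-e m)) (cong (s m) (sym actβ)))))
      (e-pos m)
    from (inj₂ (pos , neg)) = pos , subst PosRoot (act-neg (m ∷ []) (act w γ)) (s-pos m neg neg≢)
      where
      neg≢ : map -_ (act w γ) ≢ e m
      neg≢ eq = pos∧neg⇒⊥ pos (subst PosRoot (sym (from-e (trans (act-neg w γ) eq))) β-pos)
    to : N (m ∷ w) γ → γ ≡ β ⊎ N w γ
    to (pos , neg) with root-sign (IsRoot-act w (proj₁ pos))
    ... | inj₂ neg′ = inj₂ (pos , neg′)
    ... | inj₁ pos′ with act w γ ≟ⱽ e m
    ...   | yes eq = inj₁ (from-e eq)
    ...   | no neq = ⊥-elim (pos∧neg⇒⊥ (s-pos m pos′ neq) neg)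

  reduced⇒inversions-enumerate : ∀ {w} → Reduced w → Enumerates (inversions w) (N w)
  reduced⇒inversions-enumerate {[]} _ = [] , λ γ → mk⇔ (λ ()) (λ (pos , neg) → ⊥-elim (pos∧neg⇒⊥ pos neg))
  reduced⇒inversions-enumerate {m ∷ w} red
    with uniq , enum ← reduced⇒inversions-enumerate {w} (reduced-tail {m} {w} red)
    = All.tabulate fresh ∷ uniq , λ γ → mk⇔ (from (N-∷ m w β-pos actβ γ) ∘ Sum.map₂ (to (enum γ)) ∘ Any.toSum)
                                            (Any.fromSum ∘ Sum.map₂ (from (enum γ)) ∘ to (N-∷ m w β-pos actβ γ))
    where
    open Equivalence
    β = act (reverse w) (e m)
    β-pos = reduced-head-positive {m} {w} red
    actβ : act w β ≡ e m
    actβ = act-reverseʳ w (e m)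
    -- A repetition would make β an inversion of `w`, although `w` sends it to the positive root
    -- `e m`.
    fresh : ∀ {γ} → γ ∈ inversions w → β ≢ γ
    fresh γ∈ refl = pos∧neg⇒⊥ (subst PosRoot (sym actβ) (e-pos m)) (proj₂ (to (enum β) γ∈))

-- Coefficients and positivity in the abelian grading.

module Abelian {n : ℕ} (A : Matrix n) (C : IsSimpleCartan A) (i : Fin n)
  (θ : Vec ℤ n) (θ-highest : RS.IsHighestRoot A i θ) (θi≡1 : lookup θ i ≡ + 1) where
  open RS A i
  open import Data.Integer using (_+_)
  open Form A C i
  open LinComb
  open Roots A C i
  open Weyl A C i

  coef≤1 : ∀ {γ} → IsRoot γ → lookup γ i ≤ + 1
  coef≤1 {γ} r = subst (lookup γ i ≤_) θi≡1 (proj₂ θ-highest γ r i)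

  -1≤coef : ∀ {γ} → IsRoot γ → - + 1 ≤ lookup γ i
  -1≤coef {γ} r = subst (- + 1 ≤_)
    (trans (cong -_ (Vecₚ.lookup-map i -_ γ)) (ℤₚ.neg-involutive (lookup γ i)))
    (ℤₚ.neg-mono-≤ (coef≤1 (IsRoot-neg r)))

  neg-coef : ∀ {γ c} → lookup γ i ≡ c → lookup (map -_ γ) i ≡ - c
  neg-coef {γ} eq = trans (Vecₚ.lookup-map i -_ γ) (cong -_ eq)

  Δ1-pos : ∀ {γ} → Δ1 γ → PosRoot γ
  Δ1-pos {γ} (r , γi≡1) = [ id , (λ (_ , neg) → ⊥-elim (1≰0 (subst (_≤ + 0) γi≡1 (NonNeg-neg γ neg i)))) ]′ (root-sign r)
    where
    1≰0 : ¬ + 1 ≤ + 0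
    1≰0 (+≤+ ())

  e-Δ0⁺ : ∀ {j} → i ≢ j → Δ0⁺ (e j)
  e-Δ0⁺ {j} i≢j = e-pos j , e-other (i≢j ∘ sym)

  -- With zero coefficient at `i`, only the simple roots in Π(0) contribute to the image.
  act-nonNeg-Δ0 : ∀ w {x} → (∀ j → i ≢ j → PosRoot (act w (e j))) →
                NonNeg x → lookup x i ≡ + 0 → NonNeg (act w x)
  act-nonNeg-Δ0 w {x} pos nonneg xi≡0 = act-nonNeg w term nonneg
    where
    term : ∀ k → lookup x k ≡ + 0 ⊎ NonNeg (act w (e k))
    term k with i Fin.≟ k
    ... | yes refl = inj₁ xi≡0
    ... | no  i≢k  = inj₂ (proj₂ (pos k i≢k))

  simples⇒InW0 : ∀ w → (∀ j → i ≢ j → PosRoot (act w (e j))) → InW0 w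
  simples⇒InW0 w pos α ((r , nonneg) , αi≡0) = IsRoot-act w r , act-nonNeg-Δ0 w {α} pos nonneg αi≡0

  -- The partial order and monotonicity of the action.

  ≼-refl : ∀ γ → γ ≼ γ
  ≼-refl γ = (λ k → ℤₚ.≤-refl) , ℤₚ.+-inverseʳ (lookup γ i)

  ≼-trans : ∀ {x y z} → x ≼ y → y ≼ z → x ≼ z
  ≼-trans {x} {y} {z} (x≤y , xy) (y≤z , yz) =
    (λ k → ℤₚ.≤-trans (x≤y k) (y≤z k)) ,
    trans (cong (λ t → lookup z i - t) (sym (ℤₚ.i-j≡0⇒i≡j (lookup y i) (lookup x i) xy))) yz

  ≼-antisym : ∀ {x y} → x ≼ y → y ≼ x → x ≡ y
  ≼-antisym (x≤y , _) (y≤x , _) = lookup-ext λ k → ℤₚ.≤-antisym (x≤y k) (y≤x k)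

  _≼?_ : ∀ x y → Dec (x ≼ y)
  x ≼? y = Finₚ.all? (λ k → lookup x k ℤₚ.≤? lookup y k) ×-dec (lookup y i - lookup x i ℤₚ.≟ + 0)

  lookup-difference : ∀ x y k → lookup (difference x y) k ≡ lookup x k - lookup y k
  lookup-difference x y k = Vecₚ.lookup-zipWith _-_ k x y

  difference-nonNeg : ∀ {x y} → (∀ k → lookup y k ≤ lookup x k) → NonNeg (difference x y)
  difference-nonNeg {x} {y} y≤x k = subst (+ 0 ≤_) (sym (lookup-difference x y k)) (ℤₚ.i≤j⇒0≤j-i (y≤x k))

  ≼∧height≥⇒≡ : ∀ {μ γ} → μ ≼ γ → height γ ≤ height μ → μ ≡ γ
  ≼∧height≥⇒≡ {μ} {γ} (μ≤γ , _) ht = lookup-ext λ k → sym (ℤₚ.i-j≡0⇒i≡j (lookup γ k) (lookup μ k)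
    (trans (sym (lookup-difference γ μ k)) (∑-nonNeg-≡0 (difference-nonNeg {γ} {μ} μ≤γ) ht≤0 k)))
    where
    simp : ∀ a b → + 1 * a + - + 1 * b ≡ a - b
    simp = solve-∀
    ht≤0 : height (difference γ μ) ≤ + 0
    ht≤0 = subst (_≤ + 0) (sym (trans (height-lin (difference-lin γ μ)) (simp (height γ) (height μ))))
      (ℤₚ.i≤j⇒i-j≤0 ht)

  -- The difference γ - μ is a nonnegative combination of Π(0), which `w` sends to a nonnegative
  -- vector.
  act-mono-≼ : ∀ {w μ γ} → InW0 w → μ ≼ γ → ∀ k → lookup (act w μ) k ≤ lookup (act w γ) k
  act-mono-≼ {w} {μ} {γ} w∈W0 (μ≤γ , eq) k = ℤₚ.0≤i-j⇒j≤i (subst (+ 0 ≤_)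
    (trans (coord (act-lin w (difference-lin γ μ)) k) (simp (lookup (act w γ) k) (lookup (act w μ) k)))
    (act-nonNeg-Δ0 w {difference γ μ} (λ j i≢j → w∈W0 (e j) (e-Δ0⁺ i≢j)) (difference-nonNeg {γ} {μ} μ≤γ)
      (trans (lookup-difference γ μ i) eq) k))
    where
    simp : ∀ a b → + 1 * a + - + 1 * b ≡ a - b
    simp = solve-∀

  -- The sets `I w` and `N w` and their extremal elements.

  I⇒pos : ∀ w {γ} → I w γ → PosRoot (act w γ)
  I⇒pos w (Δ1γ , ¬N) = [ id , (λ neg → ⊥-elim (¬N (Δ1-pos Δ1γ , neg))) ]′ (root-sign (IsRoot-act w (proj₁ Δ1γ)))

  pos⇒I : ∀ w {γ} → Δ1 γ → PosRoot (act w γ) → I w γ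
  pos⇒I w Δ1γ pos = Δ1γ , λ (_ , neg) → pos∧neg⇒⊥ pos neg

  neg⇒N : ∀ w {γ} → Δ1 γ → NegRoot (act w γ) → N w γ
  neg⇒N w Δ1γ neg = Δ1-pos Δ1γ , neg

  I⊎N : ∀ w {γ} → Δ1 γ → I w γ ⊎ N w γ
  I⊎N w Δ1γ = Sum.map (pos⇒I w Δ1γ) (neg⇒N w Δ1γ) (root-sign (IsRoot-act w (proj₁ Δ1γ)))

  -- A positive root has coefficient 0 or 1 at `i`, and those of coefficient 0 stay positive under
  -- `w`.
  N⇒Δ1 : ∀ {w γ} → InW0 w → N w γ → Δ1 γ
  N⇒Δ1 {w} {γ} w∈W0 ((r , nonneg) , neg) = [ (λ γi≡0 → ⊥-elim (pos∧neg⇒⊥ (w∈W0 γ ((r , nonneg) , γi≡0)) neg)) , (r ,_) ]′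
    (0≤∧≤1 (nonneg i) (coef≤1 r))

  I-upper : ∀ {w} → InW0 w → UpperIdeal (I w)
  I-upper {w} w∈W0 = (λ γ → proj₁) , λ γ μ γ∈I Δ1μ γ≼μ → pos⇒I w Δ1μ
    (IsRoot-act w (proj₁ Δ1μ) , λ k → ℤₚ.≤-trans (proj₂ (I⇒pos w γ∈I) k) (act-mono-≼ {w} w∈W0 γ≼μ k))

  pos≤e⇒≡e : ∀ {β} j → PosRoot β → (∀ k → lookup β k ≤ lookup (e j) k) → β ≡ e j
  pos≤e⇒≡e j (r , nonneg) β≤e = single-support⇒simple j (proj₂ (IsRoot⇒RootLike r)) nonneg
    λ k j≢k → ℤₚ.≤-antisym (ℤₚ.≤-trans (β≤e k) (ℤₚ.≤-reflexive (e-other j≢k))) (nonneg k)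

  -- An element μ of `I w` below γ has a positive image bounded by a simple root, hence equal to it;
  -- `w` is injective.
  simple⇒Min-I : ∀ {w γ} → InW0 w → Δ1 γ → Simple (act w γ) → Min (I w) γ
  simple⇒Min-I {w} {γ} w∈W0 Δ1γ (j , eq) =
    pos⇒I w Δ1γ (subst PosRoot (sym eq) (e-pos j)) ,
    λ μ μ∈I μ≼γ → act-injective w (trans
      (pos≤e⇒≡e j (I⇒pos w μ∈I) (λ k → subst (λ t → lookup (act w μ) k ≤ lookup t k) eq (act-mono-≼ {w} w∈W0 μ≼γ k)))
      (sym eq))

  simple⇒Max-N : ∀ {w γ} → InW0 w → Δ1 γ → Simple (map -_ (act w γ)) → Max (N w) γ
  simple⇒Max-N {w} {γ} w∈W0 Δ1γ (j , eq) =
    neg⇒N w Δ1γ (subst PosRoot (sym eq) (e-pos j)) ,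
    λ μ (_ , neg) γ≼μ → act-injective w (neg-injective (trans
      (pos≤e⇒≡e j neg (λ k → subst₂ _≤_ (sym (Vecₚ.lookup-map k -_ (act w μ)))
         (trans (sym (Vecₚ.lookup-map k -_ (act w γ))) (cong (λ t → lookup t k) eq))
         (ℤₚ.neg-mono-≤ (act-mono-≼ {w} w∈W0 γ≼μ k))))
      (sym eq)))
    where
    neg-injective : ∀ {x y} → map -_ x ≡ map -_ y → x ≡ y
    neg-injective {x} {y} eq = trans (sym (neg-involutive x)) (trans (cong (λ t → map -_ t) eq) (neg-involutive y))

  IsRoot-act⁻¹ : ∀ w {x} → IsRoot (act w x) → IsRoot x
  IsRoot-act⁻¹ w {x} r = subst IsRoot (act-reverseˡ w x) (IsRoot-act (reverse w) r)

  -- Were δ negative, its negative would lie in Δ(0)⁺ and stay positive under `w`, against the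
  -- positivity of w(δ).
  Δ0∧pos⇒Δ0⁺ : ∀ {w δ} → InW0 w → PosRoot (act w δ) → lookup δ i ≡ + 0 → Δ0⁺ δ
  Δ0∧pos⇒Δ0⁺ {w} {δ} w∈W0 pos δi≡0 = [ id , (λ neg → ⊥-elim (pos∧neg⇒⊥ pos
      (subst PosRoot (act-neg w δ) (w∈W0 (map -_ δ) (neg , neg-coef {δ} δi≡0))))) ]′
      (root-sign (IsRoot-act⁻¹ w (proj₁ pos))) , δi≡0

  -- In a decomposition of the nonsimple positive root w(x) into two positive roots, the
  -- Δ(1)-coefficients of their preimages add up to ±1, so one of the preimages lies in Δ(0).
  W0-decomposition : ∀ {w x} → InW0 w → PosRoot (act w x) → ¬ Simple (act w x) →
    (lookup x i ≡ + 1 ⊎ lookup x i ≡ - + 1) →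
    ∃₂ λ μ δ → PosRoot (act w μ) × Δ0⁺ δ × LinComb (+ 1) x (- + 1) δ μ
  W0-decomposition {w} {x} w∈W0 pos nonsimple xi = result (nonsimple-decomposition pos nonsimple)
    where
    u = reverse w
    result : (∃₂ λ j ν → PosRoot ν × LinComb (+ 1) (act w x) (- + 1) (e j) ν) →
      ∃₂ λ μ δ → PosRoot (act w μ) × Δ0⁺ δ × LinComb (+ 1) x (- + 1) δ μ
    result (j , ν , ν-pos , ν-lin) = [ swapped , direct ]′ (unit-sum (lookup μ i) (lookup δ i)
        (-1≤coef μ-root) (coef≤1 μ-root) (-1≤coef δ-root) (coef≤1 δ-root)
        (Sum.map (trans sum) (trans sum) xi))
      where
      μ = act u ν
      δ = act u (e j)
      μ-root = IsRoot-act u (proj₁ ν-pos)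
      δ-root = IsRoot-act u (e-root j)
      wμ-pos : PosRoot (act w μ)
      wμ-pos = subst PosRoot (sym (act-reverseʳ w ν)) ν-pos
      wδ-pos : PosRoot (act w δ)
      wδ-pos = subst PosRoot (sym (act-reverseʳ w (e j))) (e-pos j)
      μ-lin : LinComb (+ 1) x (- + 1) δ μ
      μ-lin = subst (λ t → LinComb (+ 1) t (- + 1) δ μ) (act-reverseˡ w x) (act-lin u ν-lin)
      add : ∀ a b → + 1 * a + - + 1 * b + b ≡ a
      add = solve-∀
      sum : lookup μ i + lookup δ i ≡ lookup x i
      sum = trans (cong (_+ lookup δ i) (coord μ-lin i)) (add (lookup x i) (lookup δ i))
      solve-δ : ∀ a b → b ≡ + 1 * a + - + 1 * (+ 1 * a + - + 1 * b)
      solve-δ = solve-∀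
      δ-lin : LinComb (+ 1) x (- + 1) μ δ
      δ-lin = lin λ k → trans (solve-δ (lookup x k) (lookup δ k))
        (cong (λ t → + 1 * lookup x k + - + 1 * t) (sym (coord μ-lin k)))
      direct : lookup δ i ≡ + 0 → _
      direct δi≡0 = μ , δ , wμ-pos , Δ0∧pos⇒Δ0⁺ {w} w∈W0 wδ-pos δi≡0 , μ-lin
      swapped : lookup μ i ≡ + 0 → _
      swapped μi≡0 = δ , μ , wδ-pos , Δ0∧pos⇒Δ0⁺ {w} w∈W0 wμ-pos μi≡0 , δ-lin

  subtract-Δ0⁺ : ∀ {γ δ μ} → Δ0⁺ δ → LinComb (+ 1) γ (- + 1) δ μ →
                 μ ≼ γ × μ ≢ γ × lookup μ i ≡ lookup γ i
  subtract-Δ0⁺ {γ} {δ} {μ} ((r , nonneg) , δi≡0) lc =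
    ((λ k → subst (_≤ lookup γ k) (sym (coord′ k))
       (subst (lookup γ k - lookup δ k ≤_) (ℤₚ.+-identityʳ (lookup γ k))
         (ℤₚ.+-monoʳ-≤ (lookup γ k) (ℤₚ.neg-mono-≤ (nonneg k))))) ,
     ℤₚ.i≡j⇒i-j≡0 (sym μi≡γi)) ,
    (λ { refl → root-nonzero r λ k → cancel (lookup μ k) (lookup δ k) (coord′ k) }) ,
    μi≡γi
    where
    simp : ∀ a b → + 1 * a + - + 1 * b ≡ a - b
    simp = solve-∀
    coord′ : ∀ k → lookup μ k ≡ lookup γ k - lookup δ k
    coord′ k = trans (coord lc k) (simp (lookup γ k) (lookup δ k))
    μi≡γi : lookup μ i ≡ lookup γ i
    μi≡γi = trans (coord′ i) (trans (cong (λ t → lookup γ i - t) δi≡0) (ℤₚ.+-identityʳ (lookup γ i)))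
    solve-b : ∀ a b → b ≡ a - (a - b)
    solve-b = solve-∀
    cancel : ∀ a b → a ≡ a - b → b ≡ + 0
    cancel a b eq = trans (solve-b a b) (trans (cong (λ t → a - t) (sym eq)) (ℤₚ.+-inverseʳ a))

  nonsimple⇒I-below : ∀ {w γ} → InW0 w → I w γ → ¬ Simple (act w γ) → ∃ λ μ → I w μ × μ ≼ γ × μ ≢ γ
  nonsimple⇒I-below {w} {γ} w∈W0 γ∈I nonsimple =
    let μ , δ , wμ-pos , δ∈Δ0⁺ , lc = W0-decomposition {w} {γ} w∈W0 (I⇒pos w γ∈I) nonsimple (inj₁ (proj₂ (proj₁ γ∈I)))
        μ≼γ , μ≢γ , μi≡γi = subtract-Δ0⁺ {γ} {δ} {μ} δ∈Δ0⁺ lc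
    in μ , pos⇒I w (IsRoot-act⁻¹ w (proj₁ wμ-pos) , trans μi≡γi (proj₂ (proj₁ γ∈I))) wμ-pos , μ≼γ , μ≢γ

  -- Decomposing -γ as ν + δ with δ in Δ(0)⁺ and w(ν) positive gives μ = -ν = γ + δ, which lies
  -- strictly above γ and is still inverted.
  nonsimple⇒N-above : ∀ {w γ} → InW0 w → N w γ → ¬ Simple (map -_ (act w γ)) → ∃ λ μ → N w μ × γ ≼ μ × μ ≢ γ
  nonsimple⇒N-above {w} {γ} w∈W0 γ∈N nonsimple = result
    (W0-decomposition {w} {map -_ γ} w∈W0 (subst PosRoot (sym (act-neg w γ)) (proj₂ γ∈N))
      (nonsimple ∘ subst Simple (act-neg w γ)) (inj₂ (neg-coef {γ} (proj₂ Δ1γ))))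
    where
    Δ1γ : Δ1 γ
    Δ1γ = N⇒Δ1 {w} w∈W0 γ∈N
    result : (∃₂ λ ν δ → PosRoot (act w ν) × Δ0⁺ δ × LinComb (+ 1) (map -_ γ) (- + 1) δ ν) →
             ∃ λ μ → N w μ × γ ≼ μ × μ ≢ γ
    result (ν , δ , wν-pos , δ∈Δ0⁺ , lc) = μ , neg⇒N w Δ1μ neg , γ≼μ , γ≢μ ∘ sym
      where
      μ = map -_ ν
      regroup : ∀ c d → c ≡ + 1 * - (+ 1 * - c + - + 1 * d) + - + 1 * d
      regroup = solve-∀
      γ-lin : LinComb (+ 1) μ (- + 1) δ γ
      γ-lin = lin λ k → trans (regroup (lookup γ k) (lookup δ k))
        (cong (λ t → + 1 * t + - + 1 * lookup δ k)
          (trans (cong (λ t → - (+ 1 * t + - + 1 * lookup δ k)) (sym (Vecₚ.lookup-map k -_ γ)))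
            (trans (cong -_ (sym (coord lc k))) (sym (Vecₚ.lookup-map k -_ ν)))))
      below : γ ≼ μ × γ ≢ μ × lookup γ i ≡ lookup μ i
      below = subtract-Δ0⁺ {μ} {δ} {γ} δ∈Δ0⁺ γ-lin
      γ≼μ = proj₁ below
      γ≢μ = proj₁ (proj₂ below)
      Δ1μ : Δ1 μ
      Δ1μ = IsRoot-neg (IsRoot-act⁻¹ w (proj₁ wν-pos)) , trans (sym (proj₂ (proj₂ below))) (proj₂ Δ1γ)
      neg : NegRoot (act w μ)
      neg = subst PosRoot (trans (sym (neg-involutive (act w ν))) (cong (λ t → map -_ t) (sym (act-neg w ν)))) wν-pos

  Simple? : ∀ γ → Dec (Simple γ)
  Simple? γ = Finₚ.any? λ k → γ ≟ⱽ e k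

  Min-I⇒simple : ∀ {w γ} → InW0 w → Min (I w) γ → Simple (act w γ)
  Min-I⇒simple {w} {γ} w∈W0 (γ∈I , minimal) = decidable-stable (Simple? (act w γ)) λ nonsimple →
    let μ , μ∈I , μ≼γ , μ≢γ = nonsimple⇒I-below {w} w∈W0 γ∈I nonsimple in μ≢γ (minimal μ μ∈I μ≼γ)

  Max-N⇒simple : ∀ {w γ} → InW0 w → Max (N w) γ → Simple (map -_ (act w γ))
  Max-N⇒simple {w} {γ} w∈W0 (γ∈N , maximal) = decidable-stable (Simple? (map -_ (act w γ))) λ nonsimple →
    let μ , μ∈N , γ≼μ , μ≢γ = nonsimple⇒N-above {w} w∈W0 γ∈N nonsimple in μ≢γ (maximal μ μ∈N γ≼μ)

  N-cong : ∀ {w v γ} → w ≈W v → N w γ → N v γ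
  N-cong {γ = γ} w≈v (pos , neg) = pos , subst NegRoot (w≈v γ) neg

  Γ⇔Δ1∧simple : ∀ {w} → InW0 w → ∀ γ → Γ w γ ⇔ (Δ1 γ × Simple (act w γ))
  Γ⇔Δ1∧simple {w} w∈W0 γ = mk⇔ (λ γ∈Γ → proj₁ (proj₁ γ∈Γ) , Min-I⇒simple {w} w∈W0 γ∈Γ)
                                (λ (Δ1γ , simple) → simple⇒Min-I {w} w∈W0 Δ1γ simple)

  Max-N⇔Δ1∧simple : ∀ {w} → InW0 w → ∀ γ → Max (N w) γ ⇔ (Δ1 γ × Simple (map -_ (act w γ)))
  Max-N⇔Δ1∧simple {w} w∈W0 γ = mk⇔ (λ γ∈Max → N⇒Δ1 {w} w∈W0 (proj₁ γ∈Max) , Max-N⇒simple {w} w∈W0 γ∈Max)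
                                    (λ (Δ1γ , simple) → simple⇒Max-N {w} w∈W0 Δ1γ simple)

  N⇔Δ1∖I : ∀ {w} → InW0 w → ∀ γ → N w γ ⇔ (Δ1 γ × ¬ I w γ)
  N⇔Δ1∖I {w} w∈W0 γ = mk⇔ (λ γ∈N → N⇒Δ1 {w} w∈W0 γ∈N , λ (_ , γ∉N) → γ∉N γ∈N)
    (λ (Δ1γ , γ∉I) → [ (λ γ∈I → ⊥-elim (γ∉I γ∈I)) , id ]′ (I⊎N w Δ1γ))

  Max-cong : ∀ {M M′ : V → Set} → (∀ γ → M γ ⇔ M′ γ) → ∀ γ → Max M γ ⇔ Max M′ γ
  Max-cong M⇔M′ γ = mk⇔
    (λ (γ∈M , maximal) → to (M⇔M′ γ) γ∈M , λ μ μ∈M′ → maximal μ (from (M⇔M′ μ) μ∈M′))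
    (λ (γ∈M′ , maximal) → from (M⇔M′ γ) γ∈M′ , λ μ μ∈M → maximal μ (to (M⇔M′ μ) μ∈M))
    where open Equivalence

  Γ-cong : ∀ {w v} → InW0 w → InW0 v → w ≈W v → ∀ γ → Γ w γ ⇔ Γ v γ
  Γ-cong {w} {v} w∈W0 v∈W0 w≈v γ = mk⇔
    (from (Γ⇔Δ1∧simple {v} v∈W0 γ) ∘ Product.map₂ (subst Simple (w≈v γ)) ∘ to (Γ⇔Δ1∧simple {w} w∈W0 γ))
    (from (Γ⇔Δ1∧simple {w} w∈W0 γ) ∘ Product.map₂ (subst Simple (sym (w≈v γ))) ∘ to (Γ⇔Δ1∧simple {v} v∈W0 γ))
    where open Equivalence

  -- Recovering `w` from its minimal elements.

  -- As long as w(γ) is not simple, some element of `I w` lies strictly below γ and has smaller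
  -- height, so descent ends at a minimal element.
  Min-I-below : ∀ {w} → InW0 w → ∀ h γ → I w γ → height γ ≤ + h → ∃ λ μ → Γ w μ × μ ≼ γ
  below : ∀ {w} → InW0 w → ∀ h γ → I w γ → height γ ≤ + h → Dec (Simple (act w γ)) → ∃ λ μ → Γ w μ × μ ≼ γ

  Min-I-below {w} w∈W0 h γ γ∈I ht≤h = below {w} w∈W0 h γ γ∈I ht≤h (Simple? (act w γ))

  below {w} w∈W0 h γ γ∈I _ (yes simple) = γ , simple⇒Min-I {w} w∈W0 (proj₁ γ∈I) simple , ≼-refl γ
  below {w} w∈W0 h γ γ∈I ht≤h (no nonsimple) = step h ht≤h
    where
    lower = nonsimple⇒I-below {w} w∈W0 γ∈I nonsimple
    μ = proj₁ lower
    μ∈I = proj₁ (proj₂ lower)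
    μ≼γ = proj₁ (proj₂ (proj₂ lower))
    ht< : height μ < height γ
    ht< = ℤₚ.≰⇒> λ ht≥ → proj₂ (proj₂ (proj₂ lower)) (≼∧height≥⇒≡ μ≼γ ht≥)
    step : ∀ h → height γ ≤ + h → ∃ λ μ → Γ w μ × μ ≼ γ
    -- The lower root μ is positive, hence of nonnegative height, so γ cannot have height at most 0.
    step zero    ht≤0 = ⊥-elim (ℤₚ.<⇒≱ (ℤₚ.<-≤-trans ht< ht≤0) (∑-nonNeg (proj₂ (Δ1-pos (proj₁ μ∈I)))))
    step (suc h) ht≤h =
      let ν , ν∈Γ , ν≼μ = Min-I-below {w} w∈W0 h μ μ∈I (ℤₚ.i<j⇒i≤pred[j] (ℤₚ.<-≤-trans ht< ht≤h))
      in ν , ν∈Γ , ≼-trans {ν} {μ} {γ} ν≼μ μ≼γ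

  -- Each element of `I w` lies above an element of `Γ w`; that element lies in `I v`, which is an
  -- upper ideal.
  Γ⊆⇒I⊆ : ∀ {w v} → InW0 w → InW0 v → (∀ γ → Γ w γ → Γ v γ) → ∀ γ → I w γ → I v γ
  Γ⊆⇒I⊆ {w} {v} w∈W0 v∈W0 Γ⊆ γ γ∈I =
    let μ , μ∈Γ , μ≼γ = Min-I-below {w} w∈W0 ℤ.∣ height γ ∣ γ γ∈I
          (ℤₚ.≤-reflexive (sym (ℤₚ.0≤i⇒+∣i∣≡i (∑-nonNeg (proj₂ (Δ1-pos (proj₁ γ∈I)))))))
    in proj₂ (I-upper {v} v∈W0) μ γ (proj₁ (Γ⊆ μ μ∈Γ)) (proj₁ γ∈I) μ≼γ

  I⊆⇒N⊇ : ∀ {w v} → InW0 w → InW0 v → (∀ γ → I w γ → I v γ) → ∀ γ → N v γ → N w γ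
  I⊆⇒N⊇ {w} {v} w∈W0 v∈W0 I⊆ γ γ∈N = [ (λ γ∈I → ⊥-elim (proj₂ (I⊆ γ γ∈I) γ∈N)) , id ]′ (I⊎N w (N⇒Δ1 {v} v∈W0 γ∈N))

  -- Let δ be the preimage of α_j under v. If δ is positive, it is an inversion of neither element;
  -- if negative, -δ is an inversion of both. Either way w(δ) is positive.
  N-determines : ∀ w v → (∀ γ → N w γ ⇔ N v γ) → w ≈W v
  N-determines w v Nw⇔Nv = simples-positive⇒≈W w v pos
    where
    open Equivalence
    pos : ∀ j → PosRoot (act w (act (reverse v) (e j)))
    pos j = [ positive , negative ]′ (root-sign δ-root)
      where
      δ = act (reverse v) (e j)
      δ-root : IsRoot δ
      δ-root = IsRoot-act (reverse v) (e-root j)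
      vδ≡e : act v δ ≡ e j
      vδ≡e = act-reverseʳ v (e j)
      neg-act : ∀ u → map -_ (act u (map -_ δ)) ≡ act u δ
      neg-act u = trans (cong (λ t → map -_ t) (act-neg u δ)) (neg-involutive (act u δ))
      positive : PosRoot δ → PosRoot (act w δ)
      positive δ-pos = [ id , (λ neg → ⊥-elim (pos∧neg⇒⊥ (e-pos j)
          (subst NegRoot vδ≡e (proj₂ (to (Nw⇔Nv δ) (δ-pos , neg)))))) ]′ (root-sign (IsRoot-act w δ-root))
      negative : NegRoot δ → PosRoot (act w δ)
      negative δ-neg = subst PosRoot (neg-act w) (proj₂ (from (Nw⇔Nv (map -_ δ))
        (δ-neg , subst PosRoot (sym (trans (neg-act v) vδ≡e)) (e-pos j))))

  Γ-injective : ∀ w v → InW0 w → InW0 v → (∀ γ → Γ w γ ⇔ Γ v γ) → w ≈W v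
  Γ-injective w v w∈W0 v∈W0 Γ⇔ = N-determines w v λ γ → mk⇔
    (I⊆⇒N⊇ {v} {w} v∈W0 w∈W0 (Γ⊆⇒I⊆ {v} {w} v∈W0 w∈W0 (λ γ → from (Γ⇔ γ))) γ)
    (I⊆⇒N⊇ {w} {v} w∈W0 v∈W0 (Γ⊆⇒I⊆ {w} {v} w∈W0 v∈W0 (λ γ → to (Γ⇔ γ))) γ)
    where open Equivalence

  -- Antichains and their realisation by elements of W⁰.

  Δ1? : ∀ γ → Dec (Δ1 γ)
  Δ1? γ = IsRoot? γ ×-dec (lookup γ i ℤₚ.≟ + 1)

  -- Computed from the description of Γ_w as the elements of Δ(1) with simple image, which needs
  -- only the preimages of the simple roots.
  Γ-list : Word → List V
  Γ-list w = List.filter Δ1? (List.map (λ k → act (reverse w) (e k)) (List.allFin n))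

  ∈-Γ-list⇔ : ∀ {w} → InW0 w → ∀ γ → (γ ∈ Γ-list w) ⇔ Γ w γ
  ∈-Γ-list⇔ {w} w∈W0 γ = mk⇔
    (λ γ∈ → let γ∈map , Δ1γ = ∈-filter⁻ Δ1? {xs = List.map (λ k → act (reverse w) (e k)) (List.allFin n)} γ∈
                k , _ , eq = ∈-map⁻ (λ k → act (reverse w) (e k)) γ∈map
            in from (Γ⇔Δ1∧simple {w} w∈W0 γ) (Δ1γ , k , trans (cong (act w) eq) (act-reverseʳ w (e k))))
    (λ γ∈Γ → let Δ1γ , k , eq = to (Γ⇔Δ1∧simple {w} w∈W0 γ) γ∈Γ
             in ∈-filter⁺ Δ1? (subst (_∈ _) (trans (cong (act (reverse w)) (sym eq)) (act-reverseˡ w γ))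
                  (∈-map⁺ (λ k → act (reverse w) (e k)) (∈-allFin k))) Δ1γ)
    where open Equivalence

  Γ-antichain : ∀ {w} → InW0 w → Antichain
  Γ-antichain {w} w∈W0 = Γ-list w ,
    All.tabulate (λ {γ} γ∈ → proj₁ (proj₁ (to (∈-Γ-list⇔ {w} w∈W0 γ) γ∈))) ,
    λ x y x∈ y∈ → proj₂ (to (∈-Γ-list⇔ {w} w∈W0 y) y∈) x (proj₁ (to (∈-Γ-list⇔ {w} w∈W0 x) x∈))
    where open Equivalence

  -- With w(γ) = α_k, the word s_k w gains exactly the inversion γ. It stays in W⁰: a root of Δ(0)⁺
  -- sent to α_k would be γ, whose coefficient at `i` is 1.
  extend-by-Min : ∀ {w γ} → InW0 w → Γ w γ → ∃ λ w′ → InW0 w′ × (∀ δ → N w′ δ ⇔ (δ ≡ γ ⊎ N w δ))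
  extend-by-Min {w} {γ} w∈W0 γ∈Γ = k ∷ w ,
    (λ α α∈Δ0⁺ → s-pos k (w∈W0 α α∈Δ0⁺) λ eq → 0≢1 (trans (sym (proj₂ α∈Δ0⁺))
       (trans (cong (λ t → lookup t i) (act-injective w (trans eq (sym wγ≡e)))) (proj₂ Δ1γ)))) ,
    N-∷ k w (Δ1-pos Δ1γ) wγ≡e
    where
    Δ1γ = proj₁ (proj₁ γ∈Γ)
    k = proj₁ (Min-I⇒simple {w} w∈W0 γ∈Γ)
    wγ≡e : act w γ ≡ e k
    wγ≡e = proj₂ (Min-I⇒simple {w} w∈W0 γ∈Γ)
    0≢1 : + 0 ≢ + 1
    0≢1 ()

  highest-element : ∀ x xs → ∃ λ m → m ∈ x ∷ xs × (∀ {y} → y ∈ x ∷ xs → height y ≤ height m)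
  highest-element x xs = argmax height x xs , [ here , there ]′ (argmax-sel height x xs) ,
    λ { (here refl) → f[⊥]≤f[argmax] {f = height} x xs
      ; (there y∈)  → All.lookup (f[xs]≤f[argmax] {f = height} x xs) y∈ }

  -- Removing an element of maximal height from a lower ideal leaves a lower ideal, and the
  -- removed element is minimal in the complement of the latter.
  lower-ideal⇒N : ∀ h L → length L ℕ.≤ h → (∀ {x} → x ∈ L → Δ1 x) →
    (∀ {x y} → y ∈ L → Δ1 x → x ≼ y → x ∈ L) → ∃ λ w → InW0 w × (∀ γ → N w γ ⇔ (γ ∈ L))
  lower-ideal⇒N h [] _ _ _ = [] , (λ _ → proj₁) , λ γ →
    mk⇔ (λ (pos , neg) → ⊥-elim (pos∧neg⇒⊥ pos neg)) (λ ())
  lower-ideal⇒N (suc h) (x ∷ xs) len L⊆Δ1 lower = w′ , w′∈W0 , λ γ → mk⇔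
      ([ (λ { refl → m∈L }) , (λ γ∈N → proj₁ (∈-filter⁻ ≢m? (to (N⇔ γ) γ∈N))) ]′ ∘ to (N′⇔ γ))
      (λ γ∈L → from (N′⇔ γ) (membership γ∈L))
    where
    open Equivalence
    L = x ∷ xs
    m = proj₁ (highest-element x xs)
    m∈L : m ∈ L
    m∈L = proj₁ (proj₂ (highest-element x xs))
    highest : ∀ {y} → y ∈ L → height y ≤ height m
    highest = proj₂ (proj₂ (highest-element x xs))
    ≢m? : ∀ y → Dec (y ≢ m)
    ≢m? y = ¬? (y ≟ⱽ m)
    L′ = List.filter ≢m? L
    lower′ : ∀ {x y} → y ∈ L′ → Δ1 x → x ≼ y → x ∈ L′
    lower′ {x} {y} y∈L′ Δ1x x≼y =
      let y∈L , y≢m = ∈-filter⁻ ≢m? y∈L′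
      -- If `x` were `m`, then `y` would lie above `m` without being higher, forcing `y` to be the
      -- removed element.
      in ∈-filter⁺ ≢m? (lower y∈L Δ1x x≼y) λ { refl → y≢m (sym (≼∧height≥⇒≡ x≼y (highest y∈L))) }
    smaller : ∃ λ w → InW0 w × (∀ γ → N w γ ⇔ (γ ∈ L′))
    smaller = lower-ideal⇒N h L′
      (ℕ.s≤s⁻¹ (ℕₚ.≤-trans (Listₚ.filter-notAll ≢m? L (Any.map (λ eq y≢m → y≢m (sym eq)) m∈L)) len))
      (λ y∈L′ → L⊆Δ1 (proj₁ (∈-filter⁻ ≢m? y∈L′))) lower′
    w = proj₁ smaller
    w∈W0 = proj₁ (proj₂ smaller)
    N⇔ = proj₂ (proj₂ smaller)
    m∈Γ : Γ w m
    m∈Γ = (L⊆Δ1 m∈L , λ m∈N → proj₂ (∈-filter⁻ ≢m? {xs = L} (to (N⇔ m) m∈N)) refl) ,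
      λ μ (Δ1μ , μ∉N) μ≼m → decidable-stable (μ ≟ⱽ m) λ μ≢m →
        μ∉N (from (N⇔ μ) (∈-filter⁺ ≢m? (lower m∈L Δ1μ μ≼m) μ≢m))
    extended = extend-by-Min {w} w∈W0 m∈Γ
    w′ = proj₁ extended
    w′∈W0 = proj₁ (proj₂ extended)
    N′⇔ = proj₂ (proj₂ extended)
    membership : ∀ {γ} → γ ∈ L → γ ≡ m ⊎ N w γ
    membership {γ} γ∈L with γ ≟ⱽ m
    ... | yes γ≡m = inj₁ γ≡m
    ... | no  γ≢m = inj₂ (from (N⇔ γ) (∈-filter⁺ ≢m? γ∈L γ≢m))

  -- The elements of Δ(1) above no member of `L` form a lower ideal, realised as some `N w`. Then
  -- `I w` is the upper ideal generated by `L`, and its minimal elements are exactly the members of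
  -- the antichain.
  Γ-surjective : ∀ (a : Antichain) → ∃ λ w → InW0 w × (∀ γ → (γ ∈ proj₁ a) ⇔ Γ w γ)
  Γ-surjective (L , L⊆Δ1 , antichain) = w , w∈W0 , λ γ → mk⇔ (minimal γ) (generator γ)
    where
    open Equivalence
    Above : V → Set
    Above γ = Any (_≼ γ) L
    Below : V → Set
    Below γ = Δ1 γ × ¬ Above γ
    Above? : ∀ γ → Dec (Above γ)
    Above? γ = Any.any? (_≼? γ) L
    Below? : ∀ γ → Dec (Below γ)
    Below? γ = Δ1? γ ×-dec ¬? (Above? γ)
    -- Positive roots are nonnegative and bounded by the highest root, so `box θ` contains every
    -- candidate.
    Js = List.filter Below? (box θ)
    ∈Js⇔ : ∀ γ → (γ ∈ Js) ⇔ Below γ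
    ∈Js⇔ γ = mk⇔ (λ γ∈Js → proj₂ (∈-filter⁻ Below? {xs = box θ} γ∈Js))
      (λ γ∈ → ∈-filter⁺ Below? (∈-box θ γ (proj₂ (Δ1-pos (proj₁ γ∈))) (proj₂ θ-highest γ (proj₁ (proj₁ γ∈)))) γ∈)
    lower : ∀ {x y} → y ∈ Js → Δ1 x → x ≼ y → x ∈ Js
    lower {x} {y} y∈Js Δ1x x≼y = from (∈Js⇔ x) (Δ1x ,
      λ above → proj₂ (to (∈Js⇔ y) y∈Js) (Any.map (λ {z} z≼x → ≼-trans {z} {x} {y} z≼x x≼y) above))
    ideal = lower-ideal⇒N (length Js) Js ℕₚ.≤-refl (λ {x} x∈Js → proj₁ (to (∈Js⇔ x) x∈Js)) lower
    w = proj₁ ideal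
    w∈W0 = proj₁ (proj₂ ideal)
    N⇔ = proj₂ (proj₂ ideal)
    I⇒Above : ∀ {γ} → I w γ → Above γ
    I⇒Above {γ} (Δ1γ , γ∉N) = decidable-stable (Above? γ) λ not-above → γ∉N (from (N⇔ γ) (from (∈Js⇔ γ) (Δ1γ , not-above)))
    Above⇒I : ∀ {γ} → Δ1 γ → Above γ → I w γ
    Above⇒I {γ} Δ1γ above = Δ1γ , λ γ∈N → proj₂ (to (∈Js⇔ γ) (to (N⇔ γ) γ∈N)) above
    L⊆I : ∀ {x} → x ∈ L → I w x
    L⊆I {x} x∈L = Above⇒I (All.lookup L⊆Δ1 x∈L) (lose x∈L (≼-refl x))
    minimal : ∀ γ → γ ∈ L → Γ w γ
    minimal γ γ∈L = L⊆I γ∈L , λ μ μ∈I μ≼γ →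
      -- Here x ≼ μ ≼ γ with both ends in the antichain, so the ends agree and μ is squeezed between
      -- them.
      let x , x∈L , x≼μ = find (I⇒Above μ∈I)
          x≡γ = antichain x γ x∈L γ∈L (≼-trans {x} {μ} {γ} x≼μ μ≼γ)
      in ≼-antisym {μ} {γ} μ≼γ (subst (_≼ μ) x≡γ x≼μ)
    generator : ∀ γ → Γ w γ → γ ∈ L
    generator γ (γ∈I , γ-minimal) =
      let x , x∈L , x≼γ = find (I⇒Above γ∈I)
      in subst (_∈ L) (γ-minimal x (L⊆I x∈L) x≼γ) x∈L

  -- The cardinality of `I w`.

  -- The inversions of a shortest word for `w` enumerate `N w` without repetition, so appending them
  -- to `L` enumerates Δ(1).
  length-I : ∀ {w} → InW0 w → ∀ L M k → Enumerates L (I w) → Enumerates M Δ1 → IsLength w k →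
             length L ℕ.+ k ≡ length M
  length-I {w} w∈W0 L M k (L-unique , L⇔) (M-unique , M⇔) ((u , len , u≈w) , shortest) =
    trans (cong (length L ℕ.+_) (trans (sym len) (sym (length-inversions u))))
    (trans (sym (Listₚ.length-++ L))
      (unique∧set⇒length (Uniqueₚ.++⁺ L-unique inv-unique disjoint) M-unique λ γ → mk⇔ (to′ γ) (from′ γ)))
    where
    open Equivalence
    reduced : Reduced u
    reduced v v≈u = subst (ℕ._≤ length v) (sym len) (shortest v λ x → trans (v≈u x) (u≈w x))
    inv-unique = proj₁ (reduced⇒inversions-enumerate {u} reduced)
    inv⇔ = proj₂ (reduced⇒inversions-enumerate {u} reduced)
    inv⇒N : ∀ {γ} → γ ∈ inversions u → N w γ
    inv⇒N {γ} γ∈ = N-cong {u} {w} u≈w (to (inv⇔ γ) γ∈)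
    disjoint : ∀ {γ} → ¬ (γ ∈ L × γ ∈ inversions u)
    disjoint {γ} (γ∈L , γ∈inv) = proj₂ (to (L⇔ γ) γ∈L) (inv⇒N γ∈inv)
    to′ : ∀ γ → γ ∈ L ++ inversions u → γ ∈ M
    to′ γ γ∈ = from (M⇔ γ) ([ (λ γ∈L → proj₁ (to (L⇔ γ) γ∈L)) , (λ γ∈inv → N⇒Δ1 {w} w∈W0 (inv⇒N γ∈inv)) ]′ (∈-++⁻ L γ∈))
    from′ : ∀ γ → γ ∈ M → γ ∈ L ++ inversions u
    from′ γ γ∈M = [ (λ γ∈I → ∈-++⁺ˡ (from (L⇔ γ) γ∈I)) ,
      (λ γ∈N → ∈-++⁺ʳ L (from (inv⇔ γ) (N-cong {w} {u} (λ x → sym (u≈w x)) γ∈N))) ]′ (I⊎N w (to (M⇔ γ) γ∈M))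

  -- Cosets of W(0) and their representatives in W⁰.

  CosetEq-trans : ∀ {x y z} → CosetEq x y → CosetEq y z → CosetEq x z
  CosetEq-trans {x} {y} {z} (u , hu , y≈) (v , hv , z≈) = u ++ v , Allₚ.++⁺ hu hv , λ t →
    trans (z≈ t) (trans (act-++ y v t) (trans (y≈ (act v t)) (trans (sym (act-++ (x ++ u) v t))
      (cong (λ p → act p t) (Listₚ.++-assoc x u v)))))

  CosetEq-sym : ∀ {x y} → CosetEq x y → CosetEq y x
  CosetEq-sym {x} {y} (u , hu , y≈) = reverse u , All-resp-↭ (↭-sym (↭-reverse u)) hu , λ t →
    sym (trans (act-++ y (reverse u) t) (trans (y≈ (act (reverse u) t))
      (trans (act-++ x u (act (reverse u) t)) (cong (act x) (act-reverseʳ u t)))))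

  ≈W⇒CosetEq : ∀ {x y} → x ≈W y → CosetEq x y
  ≈W⇒CosetEq {x} x≈y = [] , [] , λ t → trans (sym (x≈y t)) (cong (λ p → act p t) (sym (Listₚ.++-identityʳ x)))

  W0word-fixes-coef : ∀ {u} → W0word u → ∀ x → lookup (act u x) i ≡ lookup x i
  W0word-fixes-coef {[]}    []         x = refl
  W0word-fixes-coef {j ∷ u} (j≢i ∷ hu) x = trans (s-other (act u x) j≢i) (W0word-fixes-coef hu x)

  -- With v = w u, the factor u keeps every simple root positive: α_i keeps coefficient 1, and if
  -- another α_j became negative, then w would send -u(α_j) to a positive root, making v(α_j)
  -- negative. Hence u is trivial.
  CosetEq⇒≈W : ∀ {w v} → InW0 w → InW0 v → CosetEq w v → w ≈W v
  CosetEq⇒≈W {w} {v} w∈W0 v∈W0 (u , hu , v≈) x =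
    sym (trans (v≈ x) (trans (act-++ w u x) (cong (act w) (simples-positive⇒≈[] u pos x))))
    where
    pos : ∀ j → PosRoot (act u (e j))
    pos j with i Fin.≟ j
    ... | yes refl = Δ1-pos (IsRoot-act u (e-root j) , trans (W0word-fixes-coef hu (e j)) (e-same j))
    ... | no  i≢j  = [ id , (λ neg → ⊥-elim (pos∧neg⇒⊥ (v∈W0 (e j) (e-Δ0⁺ i≢j)) (v-neg neg))) ]′
                       (root-sign (IsRoot-act u (e-root j)))
      where
      v-neg : NegRoot (act u (e j)) → NegRoot (act v (e j))
      v-neg neg = subst PosRoot
        (trans (act-neg w (act u (e j))) (cong (λ t → map -_ t) (sym (trans (v≈ (e j)) (act-++ w u (e j))))))
        (w∈W0 (map -_ (act u (e j)))
          (neg , neg-coef {act u (e j)} (trans (W0word-fixes-coef hu (e j)) (e-other (i≢j ∘ sym)))))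

  -- While some α_j in Π(0) has a negative image, exchange splits off s_j on the right, which keeps
  -- the coset and shortens the word.
  W0-representative : ∀ h w → length w ℕ.≤ h → ∃ λ w₀ → InW0 w₀ × CosetEq w₀ w
  W0-representative h w len with Finₚ.any? (λ j → ¬? (i Fin.≟ j) ×-dec NegRoot? j)
    where
    NegRoot? : ∀ j → Dec (NegRoot (act w (e j)))
    NegRoot? j = [ (λ pos → no (pos∧neg⇒⊥ pos)) , yes ]′ (root-sign (IsRoot-act w (e-root j)))
  ... | no ∄neg = w , simples⇒InW0 w (λ j i≢j →
          [ id , (λ neg → ⊥-elim (∄neg (j , i≢j , neg))) ]′ (root-sign (IsRoot-act w (e-root j)))) ,
          ≈W⇒CosetEq {w} {w} (λ _ → refl)
  ... | yes (j , i≢j , neg) = descend-coset h len (exchange w j neg)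
    where
    descend-coset : ∀ h → length w ℕ.≤ h → (∃ λ u → (w ≈W (u ∷ʳ j)) × suc (length u) ≡ length w) →
                    ∃ λ w₀ → InW0 w₀ × CosetEq w₀ w
    descend-coset zero    len (u , _ , len′) with () ← subst (ℕ._≤ 0) (sym len′) len
    descend-coset (suc h) len (u , w≈ , len′) =
      let w₀ , w₀∈W0 , w₀~u = W0-representative h u (ℕ.s≤s⁻¹ (subst (ℕ._≤ suc h) (sym len′) len))
      in w₀ , w₀∈W0 , CosetEq-trans {w₀} {u} {w} w₀~u (j ∷ [] , (i≢j ∘ sym) ∷ [] , w≈)

  -- The map sends a coset to Γ of its representative in W⁰; uniqueness of representatives reduces
  -- every clause to the bijection on W⁰.
  coset-antichain-bij : CosetAntichainBij
  coset-antichain-bij = (λ w → Γ-antichain {rep w} (rep∈W0 w)) , well-defined , injective , surjective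
    where
    open Equivalence
    rep : Word → Word
    rep w = proj₁ (W0-representative (length w) w ℕₚ.≤-refl)
    rep∈W0 : ∀ w → InW0 (rep w)
    rep∈W0 w = proj₁ (proj₂ (W0-representative (length w) w ℕₚ.≤-refl))
    rep~ : ∀ w → CosetEq (rep w) w
    rep~ w = proj₂ (proj₂ (W0-representative (length w) w ℕₚ.≤-refl))
    well-defined : ∀ w v → CosetEq w v → SameSet (Γ-list (rep w)) (Γ-list (rep v))
    well-defined w v w~v γ = ⇔-trans (∈-Γ-list⇔ {rep w} (rep∈W0 w) γ)
      (⇔-trans (Γ-cong {rep w} {rep v} (rep∈W0 w) (rep∈W0 v) rep≈ γ) (⇔-sym (∈-Γ-list⇔ {rep v} (rep∈W0 v) γ)))
      where
      rep≈ : rep w ≈W rep v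
      rep≈ = CosetEq⇒≈W {rep w} {rep v} (rep∈W0 w) (rep∈W0 v)
        (CosetEq-trans {rep w} {w} {rep v} (rep~ w)
          (CosetEq-trans {w} {v} {rep v} w~v (CosetEq-sym {rep v} {v} (rep~ v))))
    injective : ∀ w v → SameSet (Γ-list (rep w)) (Γ-list (rep v)) → CosetEq w v
    injective w v same = CosetEq-trans {w} {rep w} {v} (CosetEq-sym {rep w} {w} (rep~ w))
      (CosetEq-trans {rep w} {rep v} {v}
        (≈W⇒CosetEq {rep w} {rep v} (Γ-injective (rep w) (rep v) (rep∈W0 w) (rep∈W0 v)
          λ γ → ⇔-trans (⇔-sym (∈-Γ-list⇔ {rep w} (rep∈W0 w) γ)) (⇔-trans (same γ) (∈-Γ-list⇔ {rep v} (rep∈W0 v) γ))))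
        (rep~ v))
    surjective : ∀ (a : Antichain) → ∃ λ w → SameSet (Γ-list (rep w)) (proj₁ a)
    surjective a =
      let w , w∈W0 , a⇔Γ = Γ-surjective a
      in w , λ γ → ⇔-trans (∈-Γ-list⇔ {rep w} (rep∈W0 w) γ)
           (⇔-trans (Γ-cong {rep w} {w} (rep∈W0 w) w∈W0 (CosetEq⇒≈W {rep w} {w} (rep∈W0 w) w∈W0 (rep~ w)) γ)
                    (⇔-sym (a⇔Γ γ)))

open import Data.Nat using (_+_)

theorem3p1 : ∀ {n : ℕ} (A : Matrix n) → IsSimpleCartan A → (i : Fin n) →
    (θ : Vec ℤ n) → RS.IsHighestRoot A i θ → lookup θ i ≡ + 1 →
    let open RS A i in
    ( (∀ w → InW0 w → ∃ λ (a : Antichain) → ∀ γ → (γ ∈ proj₁ a) ⇔ Γ w γ)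
    × (∀ w v → InW0 w → InW0 v → (∀ γ → Γ w γ ⇔ Γ v γ) → w ≈W v)
    × (∀ (a : Antichain) → ∃ λ w → InW0 w × (∀ γ → (γ ∈ proj₁ a) ⇔ Γ w γ)) )
    × (∀ w → InW0 w →
    UpperIdeal (I w)
    × (∀ γ → I w γ → (Min (I w) γ ⇔ Simple (act w γ)))
    × (∀ γ → (Γ w γ ⇔ Min (I w) γ) × (Γ w γ ⇔ (Δ1 γ × Simple (act w γ))))
    × (∀ γ → N w γ → (Max (N w) γ ⇔ Simple (map -_ (act w γ))))
    × (∀ γ → (Max (N w) γ ⇔ Max (λ μ → Δ1 μ × ¬ I w μ) γ)
    × (Max (N w) γ ⇔ (Δ1 γ × Simple (map -_ (act w γ)))))
    × (∀ L M k → Enumerates L (I w) → Enumerates M Δ1 → IsLength w k →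
    length L + k ≡ length M))
    × CosetAntichainBij
theorem3p1 A C i θ θ-highest θi≡1 =
  ( (λ w w∈W0 → Γ-antichain {w} w∈W0 , ∈-Γ-list⇔ {w} w∈W0)
  , Γ-injective
  , Γ-surjective )
  , (λ w w∈W0 →
        I-upper {w} w∈W0
      , (λ γ γ∈I → mk⇔ (Min-I⇒simple {w} w∈W0) (simple⇒Min-I {w} w∈W0 (proj₁ γ∈I)))
      , (λ γ → mk⇔ id id , Γ⇔Δ1∧simple {w} w∈W0 γ)
      , (λ γ γ∈N → mk⇔ (Max-N⇒simple {w} w∈W0) (simple⇒Max-N {w} w∈W0 (N⇒Δ1 {w} w∈W0 γ∈N)))
      , (λ γ → Max-cong (N⇔Δ1∖I {w} w∈W0) γ , Max-N⇔Δ1∧simple {w} w∈W0 γ)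
      , length-I {w} w∈W0)
  , coset-antichain-bij
  where
  open Abelian A C i θ θ-highest θi≡1
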